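{- With $n,\alpha,N,L,\ell$ as below: for $0\le k\le L-1$ and $1\le i\le N-L+1$, \[ \sum_{\substack{w\in W_k^>\\ p_1(w)=i}}q^{\mathrm{quinv}'(w)}=q^{\binom{\alpha_\ell}{2}+\cdots+\binom{\alpha_{n-1}}{2}+\binom{k+1}{2}+(i-1)L}\begin{bmatrix}N-L\\ \alpha_2,\dots,\alpha_{n-1}\end{bmatrix}\begin{bmatrix}N-i\\ k,\ N-L-i+1,\ L-k-1\end{bmatrix}, \] and for $1\le k\le L$ and $1\le j\le N-L+1$, \[ \sum_{\substack{w\in W_k^{\le}\\ p_n(w)=j}}q^{\mathrm{quinv}'(w)}=q^{\binom{\alpha_\ell}{2}+\cdots+\binom{\alpha_{n-1}}{2}+\binom{k}{2}+(j-1)L}\begin{bmatrix}N-L\\ \alpha_2,\dots,\alpha_{n-1}\end{bmatrix}\begin{bmatrix}N-j\\ k-1,\ N-L-j+1,\ L-k\end{bmatrix}. \]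
   Context: $n\ge3$, $\alpha=(\alpha_2,\dots,\alpha_{n-1})$ positive integers, $|\alpha|=\sum\alpha_i$, $N>|\alpha|$, $L=N-|\alpha|$, $2\le\ell\le n$. For $0\le k\le L$, $W_k$ is the set of words $w=(w_1,\dots,w_N)$ over $\{1,\dots,n\}$ with exactly $k$ letters $n$, exactly $L-k$ letters $1$, and exactly $\alpha_i$ letters $i$ for $2\le i\le n-1$. $\mathrm{coinv}(w)=\#\{(i,j):i<j,w_i<w_j\}$, and $\mathrm{quinv}'(w)=\mathrm{coinv}(w)+\binom{\alpha_\ell}{2}+\cdots+\binom{\alpha_{n-1}}{2}+\binom{k}{2}$ for $w\in W_k$ (empty middle sum if $\ell=n$). $p_n(w)$ is the position from the left of the leftmost $n$ in $w$; $p_1(w)$ is the position counted from the right of the rightmost $1$ in the word obtained from $w$ by deleting all $n$'s. $W_k^{\le}=\{w\in W_k:p_n(w)\le p_1(w)\}$, $W_k^>=\{w\in W_k:p_n(w)>p_1(w)\}$, with conventions $W_0=W_0^>$, $W_L=W_L^{\le}$. $q$-factorials $[m]!=\prod_{s=1}^m(1+q+\cdots+q^{s-1})$; $q$-multinomial $\begin{bmatrix}m\\ \beta_1,\dots,\beta_s\end{bmatrix}=\frac{[m]!}{[\beta_1]!\cdots[\beta_s]!}$ when all $\beta_i\ge0$ and $\sum\beta_i=m$, and $0$ if some $\beta_i<0$. -}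

module Defs where

open import Data.Nat as ℕ using (ℕ; zero; suc; _∸_)
open import Data.Nat.Combinatorics using (_C_)
open import Data.Integer as ℤ using (ℤ; 0ℤ; 1ℤ; ∣_∣)
import Data.Integer.Properties as ℤₚ
open import Data.List using (List; []; _∷_; _++_; map; foldr; filter; length; replicate; reverse; upTo; cartesianProductWith)
open import Data.Nat.ListAction using (sum)
open import Data.List.Relation.Unary.All using (All; all?)
open import Data.Product using (_×_)
open import Data.Sum using (_⊎_; inj₁; inj₂; [_,_]′; map₁; map₂)
open import Data.Bool using (if_then_else_)
open import Relation.Nullary using (¬_; does; ¬?; _×-dec_; _⊎-dec_)
open import Relation.Unary using (Pred; Decidable)
open import Relation.Binary.PropositionalEquality using (_≡_; _≢_; refl; sym; trans; cong)
open import Level using (0ℓ)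

-- ℤ[q]: coefficient lists, lowest degree first.  Trailing zeros are
-- allowed, so equality is _≈_ and not _≡_.

Poly : Set
Poly = List ℤ

coeff : Poly → ℕ → ℤ
coeff []      _       = 0ℤ
coeff (a ∷ p) zero    = a
coeff (a ∷ p) (suc d) = coeff p d

infix 4 _≈_
_≈_ : Poly → Poly → Set
p ≈ r = ∀ d → coeff p d ≡ coeff r d

0ₚ 1ₚ : Poly
0ₚ = []
1ₚ = 1ℤ ∷ []

infixl 6 _+ₚ_
infixl 7 _*ₚ_

_+ₚ_ : Poly → Poly → Poly
[]      +ₚ r       = r
(a ∷ p) +ₚ []      = a ∷ p
(a ∷ p) +ₚ (b ∷ r) = a ℤ.+ b ∷ p +ₚ r

_*ₚ_ : Poly → Poly → Poly
[]      *ₚ r = []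
(a ∷ p) *ₚ r = map (a ℤ.*_) r +ₚ (0ℤ ∷ p *ₚ r)

sumₚ productₚ : List Poly → Poly
sumₚ     = foldr _+ₚ_ 0ₚ
productₚ = foldr _*ₚ_ 1ₚ

infix 8 q^_
q^_ : ℕ → Poly
q^ e = replicate e 0ℤ ++ 1ₚ

coeff-+ : ∀ p r d → coeff (p +ₚ r) d ≡ coeff p d ℤ.+ coeff r d
coeff-+ []      r       d       = sym (ℤₚ.+-identityˡ _)
coeff-+ (a ∷ p) []      d       = sym (ℤₚ.+-identityʳ _)
coeff-+ (a ∷ p) (b ∷ r) zero    = refl
coeff-+ (a ∷ p) (b ∷ r) (suc d) = coeff-+ p r d

coeff-map : ∀ a p d → coeff (map (a ℤ.*_) p) d ≡ a ℤ.* coeff p d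
coeff-map a []      d       = sym (ℤₚ.*-zeroʳ a)
coeff-map a (b ∷ p) zero    = refl
coeff-map a (b ∷ p) (suc d) = coeff-map a p d

coeff-*-zero : ∀ p r → coeff (p *ₚ r) 0 ≡ coeff p 0 ℤ.* coeff r 0
coeff-*-zero []      r = sym (ℤₚ.*-zeroˡ (coeff r 0))
coeff-*-zero (a ∷ p) r = trans (coeff-+ (map (a ℤ.*_) r) _ 0)
  (trans (ℤₚ.+-identityʳ _) (coeff-map a r 0))

coeff-∷-* : ∀ a p r d →
  coeff ((a ∷ p) *ₚ r) (suc d) ≡ a ℤ.* coeff r (suc d) ℤ.+ coeff (p *ₚ r) d
coeff-∷-* a p r d = trans (coeff-+ (map (a ℤ.*_) r) _ (suc d))
  (cong (ℤ._+ coeff (p *ₚ r) d) (coeff-map a r (suc d)))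

*-shiftʳ : ∀ p r d → coeff (p *ₚ (0ℤ ∷ r)) (suc d) ≡ coeff (p *ₚ r) d
*-shiftʳ []      r d       = refl
*-shiftʳ (a ∷ p) r zero    = trans (coeff-∷-* a p (0ℤ ∷ r) 0)
  (trans (cong (λ z → a ℤ.* coeff r 0 ℤ.+ z)
           (trans (coeff-*-zero p (0ℤ ∷ r)) (ℤₚ.*-zeroʳ (coeff p 0))))
  (trans (ℤₚ.+-identityʳ _) (sym (coeff-*-zero (a ∷ p) r))))
*-shiftʳ (a ∷ p) r (suc d) = trans (coeff-∷-* a p (0ℤ ∷ r) (suc d))
  (trans (cong (λ z → a ℤ.* coeff r (suc d) ℤ.+ z) (*-shiftʳ p r d))
         (sym (coeff-∷-* a p r d)))

≡0∷≈0 : ∀ {a p} → a ≡ 0ℤ → p ≈ 0ₚ → a ∷ p ≈ 0ₚ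
≡0∷≈0 a≡0 h zero    = a≡0
≡0∷≈0 a≡0 h (suc d) = h d

*-unshiftˡ : ∀ {a} p r → a ≡ 0ℤ → (a ∷ p) *ₚ r ≈ 0ₚ → p *ₚ r ≈ 0ₚ
*-unshiftˡ p r refl h d = trans
  (sym (trans (coeff-∷-* 0ℤ p r d)
       (trans (cong (ℤ._+ coeff (p *ₚ r) d) (ℤₚ.*-zeroˡ (coeff r (suc d))))
              (ℤₚ.+-identityˡ _))))
  (h (suc d))

*-unshiftʳ : ∀ {b} p r → b ≡ 0ℤ → p *ₚ (b ∷ r) ≈ 0ₚ → p *ₚ r ≈ 0ₚ
*-unshiftʳ p r refl h d = trans (sym (*-shiftʳ p r d)) (h (suc d))

*-integral : ∀ p r → p *ₚ r ≈ 0ₚ → p ≈ 0ₚ ⊎ r ≈ 0ₚ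
*-integral []      r  h = inj₁ (λ _ → refl)
*-integral (a ∷ p) [] h = inj₂ (λ _ → refl)
*-integral (a ∷ p) (b ∷ r) h =
  [ (λ a≡0 → map₁ (≡0∷≈0 a≡0) (*-integral p (b ∷ r) (*-unshiftˡ p (b ∷ r) a≡0 h)))
  , (λ b≡0 → map₂ (≡0∷≈0 b≡0) (*-integral (a ∷ p) r (*-unshiftʳ (a ∷ p) r b≡0 h)))
  ]′ (ℤₚ.i*j≡0⇒i≡0∨j≡0 a (trans (sym (coeff-*-zero (a ∷ p) (b ∷ r))) (h 0)))

*-nonzero : ∀ {p r} → ¬ p ≈ 0ₚ → ¬ r ≈ 0ₚ → ¬ p *ₚ r ≈ 0ₚ
*-nonzero {p} {r} p≉0 r≉0 h with *-integral p r h
... | inj₁ p≈0 = p≉0 p≈0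
... | inj₂ r≈0 = r≉0 r≈0

1+-nonzero : ∀ p → ¬ (1ℤ ∷ p) ≈ 0ₚ
1+-nonzero p h with h 0
... | ()

-- The field of fractions of ℤ[q], with equality _≃_.

record Frac : Set where
  constructor frac
  field
    num   : Poly
    den   : Poly
    den≉0 : ¬ den ≈ 0ₚ

open Frac public

infix 4 _≃_
_≃_ : Frac → Frac → Set
x ≃ y = num x *ₚ den y ≈ num y *ₚ den x

infixl 7 _·_
_·_ : Frac → Frac → Frac
x · y = frac (num x *ₚ num y) (den x *ₚ den y) (*-nonzero {den x} {den y} (den≉0 x) (den≉0 y))

⟦_⟧ : Poly → Frac
⟦ p ⟧ = frac p 1ₚ (1+-nonzero [])

q-int : ℕ → Poly
q-int s = replicate s 1ℤ

q-fact : ℕ → Poly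
q-fact zero    = 1ₚ
q-fact (suc m) = q-fact m *ₚ q-int (suc m)

q-fact-nonzero : ∀ m → ¬ q-fact m ≈ 0ₚ
q-fact-nonzero zero    = 1+-nonzero []
q-fact-nonzero (suc m) = *-nonzero {q-fact m} {q-int (suc m)} (q-fact-nonzero m) (1+-nonzero _)

q-facts-nonzero : ∀ (β : List ℤ) → ¬ productₚ (map (λ b → q-fact ∣ b ∣) β) ≈ 0ₚ
q-facts-nonzero []      = 1+-nonzero []
q-facts-nonzero (b ∷ β) = *-nonzero {q-fact ∣ b ∣} (q-fact-nonzero ∣ b ∣) (q-facts-nonzero β)

-- Only meaningful if some βᵢ is negative or the βᵢ sum to m.
q-multinomial : ℕ → List ℤ → Frac
q-multinomial m β = if does (all? (0ℤ ℤ.≤?_) β)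
  then frac (q-fact m) (productₚ (map (λ b → q-fact ∣ b ∣) β)) (q-facts-nonzero β)
  else ⟦ 0ₚ ⟧

-- Half-open: a, a+1, …, b-1
[_⋯_⟩ : ℕ → ℕ → List ℕ
[ a ⋯ b ⟩ = map (a ℕ.+_) (upTo (b ∸ a))

Word : Set
Word = List ℕ

-- Every word of length N over the alphabet {1,…,n}, each listed once.
words : (n N : ℕ) → List Word
words n zero    = [] ∷ []
words n (suc N) = cartesianProductWith _∷_ [ 1 ⋯ suc n ⟩ (words n N)

count : ℕ → Word → ℕ
count a w = length (filter (ℕ._≟ a) w)

coinv : Word → ℕ
coinv []      = 0
coinv (a ∷ w) = length (filter (a ℕ.<?_) w) ℕ.+ coinv w

-- 1-based position of the leftmost a; the junk value length w + 1 is
-- returned if a does not occur.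
position : ℕ → Word → ℕ
position a []      = 1
position a (b ∷ w) = if does (b ℕ.≟ a) then 1 else suc (position a w)

-- Parameters: only α 2, …, α (n-1) are ever used.
module Setup (n : ℕ) (α : ℕ → ℕ) (N ℓ : ℕ) where

  ∣α∣ : ℕ
  ∣α∣ = sum (map α [ 2 ⋯ n ⟩)

  L : ℕ
  L = N ∸ ∣α∣

  αs : List ℤ
  αs = map (λ i → ℤ.+ α i) [ 2 ⋯ n ⟩

  binomials : ℕ
  binomials = sum (map (λ i → α i C 2) [ ℓ ⋯ n ⟩)

  -- Membership in W_k, for words taken from `words n N`.
  W : ℕ → Pred Word 0ℓ
  W k w = count n w ≡ k × count 1 w ≡ L ∸ k × All (λ i → count i w ≡ α i) [ 2 ⋯ n ⟩

  quinv′ : ℕ → Word → ℕ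
  quinv′ k w = coinv w ℕ.+ binomials ℕ.+ k C 2

  pₙ p₁ : Word → ℕ
  pₙ w = position n w
  p₁ w = position 1 (reverse (filter (λ a → ¬? (a ℕ.≟ n)) w))

  -- The first disjunct and the condition k ≢ _ implement the conventions
  -- W_0 = W_0^> and W_L = W_L^≤ (so W_0^≤ and W_L^> are empty); the junk
  -- value of `position` is therefore never compared.
  W≤ W> : ℕ → Pred Word 0ℓ
  W≤ k w = W k w × (k ≡ L ⊎ (k ≢ 0 × pₙ w ℕ.≤ p₁ w))
  W> k w = W k w × (k ≡ 0 ⊎ (k ≢ L × pₙ w ℕ.> p₁ w))

  W? : ∀ k → Decidable (W k)
  W? k w = (count n w ℕ.≟ k) ×-dec (count 1 w ℕ.≟ L ∸ k) ×-dec all? (λ i → count i w ℕ.≟ α i) [ 2 ⋯ n ⟩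

  W≤? : ∀ k → Decidable (W≤ k)
  W≤? k w = W? k w ×-dec ((k ℕ.≟ L) ⊎-dec (¬? (k ℕ.≟ 0) ×-dec (pₙ w ℕ.≤? p₁ w)))

  W>? : ∀ k → Decidable (W> k)
  W>? k w = W? k w ×-dec ((k ℕ.≟ 0) ⊎-dec (¬? (k ℕ.≟ L) ×-dec (pₙ w ℕ.>? p₁ w)))

  -- The sum of q^{quinv′(w)} over the w of length N over {1,…,n} satisfying P,
  -- where P should imply W k.
  Σq^quinv′ : ℕ → {P : Pred Word 0ℓ} → Decidable P → Poly
  Σq^quinv′ k P? = sumₚ (map (λ w → q^ (quinv′ k w)) (filter P? (words n N)))

{-# OPTIONS --safe #-}

-- A word is determined by the positions of its letters n, the positions of the letters 1
-- among the remaining ones, and the subword v of middle letters, and coinv is the sum of the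
-- coinversion numbers of these three pieces.  The conditions on pₙ and p₁ only concern the
-- first two pieces, which are binary words: "pₙ > i and p₁ = i" says that the first i letters
-- of w are not n and that w without its n's ends in a 1 followed by i - 1 middle letters, and
-- "pₙ = j ≤ p₁" says that the first n is at j and that w without its n's ends in j - 1 middle
-- letters.  Removing the prescribed ends contributes a power of q and leaves two
-- unrestricted binary words, hence two q-binomials whose product is the trinomial of the
-- theorem; v contributes the q-multinomial in α by MacMahon's formula.

module Submission where

open import Defs hiding (_≈_)
open Defs using () renaming (_≈_ to _≈ₚ_)
open import Algebra.Bundles using (CommutativeSemiring)
import Algebra.Structures.Biased as Biased
open import Data.Bool using (Bool; true; false; _∧_)
open import Data.Empty using (⊥-elim)
open import Data.Integer as ℤ using (ℤ; 0ℤ; 1ℤ; ∣_∣)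
import Data.Integer.Properties as ℤₚ
import Data.Integer.Tactic.RingSolver as ℤ-Solver
open import Data.List using (List; []; _∷_; _∷ʳ_; _++_; map; foldr; filter; length; reverse; upTo; cartesianProductWith)
open import Data.List.Properties using (filter-accept; filter-reject; length-map; map-++; map-applyUpTo; map-upTo; reverse-map; unfold-reverse; upTo-∷ʳ)
open import Data.List.Relation.Unary.All as All using (All; []; _∷_; all?)
import Data.List.Relation.Unary.All.Properties as All
open import Data.List.Relation.Unary.AllPairs using (AllPairs; []; _∷_)
import Data.List.Relation.Unary.AllPairs.Properties as AllPairs
open import Data.Nat as ℕ using (ℕ; zero; suc; _+_; _*_; _∸_; _≤_; _<_; _≟_; _<?_; z≤n; s≤s)
open import Data.Nat.Combinatorics using (_C_; nC1≡n; nCk+nC[k+1]≡[n+1]C[k+1])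
open import Data.Nat.ListAction using (sum)
import Data.Nat.Properties as ℕₚ
open import Data.Nat.Tactic.RingSolver using (solve-∀)
open import Data.Product using (_×_; _,_)
open import Data.Sum using (_⊎_; inj₁; inj₂)
open import Data.Unit using (tt)
open import Function using (_∘_; id)
open import Function.Bundles using (_⇔_; mk⇔; module Equivalence)
open import Level using (Level; 0ℓ)
open import Relation.Binary.PropositionalEquality as ≡ using (_≡_; _≢_)
open import Relation.Binary.Structures using (IsEquivalence)
open import Relation.Nullary using (¬_; does; ¬?; yes; no; _×-dec_)
open import Relation.Nullary.Decidable using (dec-true; dec-false; does-⇔)
open import Relation.Unary using (Pred; Decidable; U)
open import Relation.Unary.Properties using (U?)

-- Words with one letter singled out

-- Fixing the value i of p₁, or j of pₙ, is what separates the pieces: a comparison of two positions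
-- becomes one condition on the letters n and another on the letters 1. The coinversions split
-- because n is the largest letter and 1 the smallest of those left. Origin of the exponents: in the
-- first formula each of the i leading letters precedes all k letters n, and each of the i - 1 last
-- middle letters follows all L - k letters 1, in total ik + (i - 1)(L - k) = k + (i - 1)L. The
-- extra k turns the binomial (k choose 2) of quinv′ into (k + 1 choose 2). In the second formula
-- the sum is (j - 1)k + (j - 1)(L - k) = (j - 1)L, with nothing extra. The product of the two
-- q-binomials is a trinomial because both removals leave the same number of letters different from
-- n. The q-multinomials are fractions, whereas the sums live in a semiring without division. Hence
-- q-binomials are introduced as generating functions of binary words, and every identity with
-- q-factorials is proved with denominators cleared.

trues falses bitCoinv firstTrue : List Bool → ℕ

trues []          = 0
trues (true  ∷ b) = suc (trues b)
trues (false ∷ b) = trues b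

falses []          = 0
falses (true  ∷ b) = falses b
falses (false ∷ b) = suc (falses b)

bitCoinv []          = 0
bitCoinv (true  ∷ b) = bitCoinv b
bitCoinv (false ∷ b) = trues b + bitCoinv b

-- 1-based, with the same junk value as `position`.
firstTrue []          = 1
firstTrue (true  ∷ b) = 1
firstTrue (false ∷ b) = suc (firstTrue b)

trues+falses : ∀ b → trues b + falses b ≡ length b
trues+falses []          = ≡.refl
trues+falses (true  ∷ b) = ≡.cong suc (trues+falses b)
trues+falses (false ∷ b) = ≡.trans (ℕₚ.+-suc (trues b) (falses b)) (≡.cong suc (trues+falses b))

0<firstTrue : ∀ b → 0 < firstTrue b
0<firstTrue []          = ℕₚ.≤-refl
0<firstTrue (true  ∷ b) = ℕₚ.≤-refl
0<firstTrue (false ∷ b) = ℕₚ.0<1+n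

-- Evaluates the junk value. It shows later that the conventions for W_0 and W_L agree with an
-- honest comparison of positions.
firstTrue-none : ∀ b → trues b ≡ 0 → firstTrue b ≡ suc (falses b)
firstTrue-none []          _  = ≡.refl
firstTrue-none (false ∷ b) eq = ≡.cong suc (firstTrue-none b eq)

trues-∷ʳ : ∀ b x → trues (b ∷ʳ x) ≡ trues (x ∷ b)
trues-∷ʳ []          x     = ≡.refl
trues-∷ʳ (true  ∷ b) true  = ≡.cong suc (trues-∷ʳ b true)
trues-∷ʳ (true  ∷ b) false = ≡.cong suc (trues-∷ʳ b false)
trues-∷ʳ (false ∷ b) true  = trues-∷ʳ b true
trues-∷ʳ (false ∷ b) false = trues-∷ʳ b false

falses-∷ʳ : ∀ b x → falses (b ∷ʳ x) ≡ falses (x ∷ b)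
falses-∷ʳ []          x     = ≡.refl
falses-∷ʳ (true  ∷ b) true  = falses-∷ʳ b true
falses-∷ʳ (true  ∷ b) false = falses-∷ʳ b false
falses-∷ʳ (false ∷ b) true  = ≡.cong suc (falses-∷ʳ b true)
falses-∷ʳ (false ∷ b) false = ≡.cong suc (falses-∷ʳ b false)

trues-∷ : ∀ x {b c} → trues b ≡ trues c → trues (x ∷ b) ≡ trues (x ∷ c)
trues-∷ true  = ≡.cong suc
trues-∷ false eq = eq

falses-∷ : ∀ x {b c} → falses b ≡ falses c → falses (x ∷ b) ≡ falses (x ∷ c)
falses-∷ true  eq = eq
falses-∷ false = ≡.cong suc

trues-reverse : ∀ b → trues (reverse b) ≡ trues b
trues-reverse []      = ≡.refl
trues-reverse (x ∷ b) = ≡.trans (≡.cong trues (unfold-reverse x b))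
  (≡.trans (trues-∷ʳ (reverse b) x) (trues-∷ x (trues-reverse b)))

falses-reverse : ∀ b → falses (reverse b) ≡ falses b
falses-reverse []      = ≡.refl
falses-reverse (x ∷ b) = ≡.trans (≡.cong falses (unfold-reverse x b))
  (≡.trans (falses-∷ʳ (reverse b) x) (falses-∷ x (falses-reverse b)))

bitCoinv-∷ʳ-true : ∀ b → bitCoinv (b ∷ʳ true) ≡ falses b + bitCoinv b
bitCoinv-∷ʳ-true []          = ≡.refl
bitCoinv-∷ʳ-true (true  ∷ b) = bitCoinv-∷ʳ-true b
bitCoinv-∷ʳ-true (false ∷ b) = ≡.trans
  (≡.cong₂ _+_ (trues-∷ʳ b true) (bitCoinv-∷ʳ-true b))
  (shuffle (trues b) (falses b) (bitCoinv b))
  where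
  shuffle : ∀ x y z → suc x + (y + z) ≡ suc y + (x + z)
  shuffle = solve-∀

bitCoinv-∷ʳ-false : ∀ b → bitCoinv (b ∷ʳ false) ≡ bitCoinv b
bitCoinv-∷ʳ-false []          = ≡.refl
bitCoinv-∷ʳ-false (true  ∷ b) = bitCoinv-∷ʳ-false b
bitCoinv-∷ʳ-false (false ∷ b) = ≡.cong₂ _+_ (trues-∷ʳ b false) (bitCoinv-∷ʳ-false b)

-- The positions of one letter and the word of the others

marks : ℕ → Word → List Bool
marks a = map (λ x → does (x ≟ a))

without : ℕ → Word → Word
without a = filter (λ x → ¬? (x ≟ a))

marks-≡ : ∀ a w → marks a (a ∷ w) ≡ true ∷ marks a w
marks-≡ a w = ≡.cong (_∷ marks a w) (dec-true (a ≟ a) ≡.refl)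

marks-≢ : ∀ {a x} w → x ≢ a → marks a (x ∷ w) ≡ false ∷ marks a w
marks-≢ {a} {x} w x≢a = ≡.cong (_∷ marks a w) (dec-false (x ≟ a) x≢a)

without-≡ : ∀ a w → without a (a ∷ w) ≡ without a w
without-≡ a w = filter-reject (λ x → ¬? (x ≟ a)) (λ a≢a → a≢a ≡.refl)

without-≢ : ∀ {a x} w → x ≢ a → without a (x ∷ w) ≡ x ∷ without a w
without-≢ {a} w x≢a = filter-accept (λ x → ¬? (x ≟ a)) x≢a

count-≡ : ∀ a w → count a (a ∷ w) ≡ suc (count a w)
count-≡ a w = ≡.cong length (filter-accept (_≟ a) ≡.refl)

count-≢ : ∀ {a x} w → x ≢ a → count a (x ∷ w) ≡ count a w
count-≢ {a} w x≢a = ≡.cong length (filter-reject (_≟ a) x≢a)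

count-marks : ∀ a w → count a w ≡ trues (marks a w)
count-marks a []      = ≡.refl
count-marks a (x ∷ w) with x ≟ a
... | yes ≡.refl rewrite marks-≡ a w | count-≡ a w = ≡.cong suc (count-marks a w)
... | no x≢a   rewrite marks-≢ w x≢a | count-≢ w x≢a = count-marks a w

falses-marks : ∀ a w → falses (marks a w) ≡ length (without a w)
falses-marks a []      = ≡.refl
falses-marks a (x ∷ w) with x ≟ a
... | yes ≡.refl rewrite marks-≡ a w | without-≡ a w = falses-marks a w
... | no x≢a   rewrite marks-≢ w x≢a | without-≢ w x≢a = ≡.cong suc (falses-marks a w)

count-without : ∀ {a i} w → i ≢ a → count i (without a w) ≡ count i w
count-without         []      i≢a = ≡.refl
count-without {a} {i} (x ∷ w) i≢a with x ≟ a | x ≟ i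
... | yes ≡.refl | yes ≡.refl = ⊥-elim (i≢a ≡.refl)
... | yes ≡.refl | no  x≢i  rewrite without-≡ a w | count-≢ w x≢i = count-without w i≢a
... | no  x≢a  | yes ≡.refl rewrite without-≢ w x≢a | count-≡ i w | count-≡ i (without a w) =
  ≡.cong suc (count-without w i≢a)
... | no  x≢a  | no  x≢i  rewrite without-≢ w x≢a | count-≢ w x≢i | count-≢ (without a w) x≢i =
  count-without w i≢a

position-marks : ∀ a w → position a w ≡ firstTrue (marks a w)
position-marks a []      = ≡.refl
position-marks a (x ∷ w) with does (x ≟ a)
... | true  = ≡.refl
... | false = ≡.cong suc (position-marks a w)

position-reverse : ∀ a w → position a (reverse w) ≡ firstTrue (reverse (marks a w))
position-reverse a w = ≡.trans (position-marks a (reverse w)) (≡.cong firstTrue (reverse-map _ w))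

-- Splitting off the coinversions of an extreme letter

above : ℕ → Word → ℕ
above x w = length (filter (x <?_) w)

above-< : ∀ {x y} w → x < y → above x (y ∷ w) ≡ suc (above x w)
above-< {x} w x<y = ≡.cong length (filter-accept (x <?_) x<y)

above-≮ : ∀ {x y} w → ¬ x < y → above x (y ∷ w) ≡ above x w
above-≮ {x} w x≮y = ≡.cong length (filter-reject (x <?_) x≮y)

above-max : ∀ {a} w → All (_≤ a) w → above a w ≡ 0
above-max []      []          = ≡.refl
above-max (y ∷ w) (y≤a ∷ w≤a) = ≡.trans (above-≮ w (ℕₚ.≤⇒≯ y≤a)) (above-max w w≤a)

above-min : ∀ {a} w → All (a ≤_) w → above a w ≡ falses (marks a w)
above-min     []      []          = ≡.refl
above-min {a} (y ∷ w) (a≤y ∷ a≤w) with y ≟ a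
... | yes ≡.refl rewrite marks-≡ a w | above-≮ w (ℕₚ.n≮n a) = above-min w a≤w
... | no y≢a   rewrite marks-≢ w y≢a | above-< w (ℕₚ.≤∧≢⇒< a≤y (y≢a ∘ ≡.sym)) =
  ≡.cong suc (above-min w a≤w)

above-below : ∀ {a x} w → x < a → above x w ≡ trues (marks a w) + above x (without a w)
above-below         []      x<a = ≡.refl
above-below {a} {x} (y ∷ w) x<a with y ≟ a | x <? y
... | yes ≡.refl | _ rewrite marks-≡ a w | without-≡ a w | above-< w x<a = ≡.cong suc (above-below w x<a)
... | no y≢a | yes x<y rewrite marks-≢ w y≢a | without-≢ w y≢a | above-< w x<y | above-< (without a w) x<y =
  ≡.trans (≡.cong suc (above-below w x<a)) (≡.sym (ℕₚ.+-suc _ _))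
... | no y≢a | no x≮y rewrite marks-≢ w y≢a | without-≢ w y≢a | above-≮ w x≮y | above-≮ (without a w) x≮y =
  above-below w x<a

above-above : ∀ {a x} w → a < x → above x w ≡ above x (without a w)
above-above         []      a<x = ≡.refl
above-above {a} {x} (y ∷ w) a<x with y ≟ a | x <? y
... | yes ≡.refl | _ rewrite without-≡ a w | above-≮ w (ℕₚ.<⇒≯ a<x) = above-above w a<x
... | no y≢a | yes x<y rewrite without-≢ w y≢a | above-< w x<y | above-< (without a w) x<y =
  ≡.cong suc (above-above w a<x)
... | no y≢a | no x≮y rewrite without-≢ w y≢a | above-≮ w x≮y | above-≮ (without a w) x≮y =
  above-above w a<x

-- A maximal a starts no coinversion and ends one with every smaller letter before it. These pairs
-- are exactly the pairs of a false before a true in the marks.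
coinv-max : ∀ {a} w → All (_≤ a) w → coinv w ≡ bitCoinv (marks a w) + coinv (without a w)
coinv-max     []      []          = ≡.refl
coinv-max {a} (x ∷ w) (x≤a ∷ w≤a) with x ≟ a
... | yes ≡.refl rewrite marks-≡ a w | without-≡ a w | above-max w w≤a = coinv-max w w≤a
... | no x≢a   rewrite marks-≢ w x≢a | without-≢ w x≢a = ≡.trans
  (≡.cong₂ _+_ (above-below w (ℕₚ.≤∧≢⇒< x≤a x≢a)) (coinv-max w w≤a))
  (shuffle (trues (marks a w)) (above x (without a w)) (bitCoinv (marks a w)) (coinv (without a w)))
  where
  shuffle : ∀ s t u v → s + t + (u + v) ≡ s + u + (t + v)
  shuffle = solve-∀

bitCoinv-reverse-true : ∀ b → bitCoinv (reverse (true ∷ b)) ≡ falses b + bitCoinv (reverse b)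
bitCoinv-reverse-true b = ≡.trans (≡.cong bitCoinv (unfold-reverse true b))
  (≡.trans (bitCoinv-∷ʳ-true (reverse b)) (≡.cong (_+ bitCoinv (reverse b)) (falses-reverse b)))

bitCoinv-reverse-false : ∀ b → bitCoinv (reverse (false ∷ b)) ≡ bitCoinv (reverse b)
bitCoinv-reverse-false b = ≡.trans (≡.cong bitCoinv (unfold-reverse false b)) (bitCoinv-∷ʳ-false (reverse b))

-- For a minimal a the coinversions are the pairs of a true before a false, so reversing the marks
-- brings them back to `bitCoinv`. The same reversal suits p₁, which counts from the right.
coinv-min : ∀ {a} w → All (a ≤_) w → coinv w ≡ bitCoinv (reverse (marks a w)) + coinv (without a w)
coinv-min     []      []          = ≡.refl
coinv-min {a} (x ∷ w) (a≤x ∷ a≤w) with x ≟ a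
... | yes ≡.refl = begin
  above a w + coinv w
    ≡⟨ ≡.cong₂ _+_ (above-min w a≤w) (coinv-min w a≤w) ⟩
  falses (marks a w) + (bitCoinv (reverse (marks a w)) + coinv (without a w))
    ≡⟨ ℕₚ.+-assoc (falses (marks a w)) _ _ ⟨
  falses (marks a w) + bitCoinv (reverse (marks a w)) + coinv (without a w)
    ≡⟨ ≡.cong₂ _+_ (bitCoinv-reverse-true (marks a w)) (≡.cong coinv (without-≡ a w)) ⟨
  bitCoinv (reverse (true ∷ marks a w)) + coinv (without a (a ∷ w))
    ≡⟨ ≡.cong (λ b → bitCoinv (reverse b) + coinv (without a (a ∷ w))) (marks-≡ a w) ⟨
  bitCoinv (reverse (marks a (a ∷ w))) + coinv (without a (a ∷ w)) ∎
  where open ≡.≡-Reasoning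
... | no x≢a = begin
  above x w + coinv w
    ≡⟨ ≡.cong₂ _+_ (above-above w (ℕₚ.≤∧≢⇒< a≤x (x≢a ∘ ≡.sym))) (coinv-min w a≤w) ⟩
  above x (without a w) + (bitCoinv (reverse (marks a w)) + coinv (without a w))
    ≡⟨ shuffle (above x (without a w)) (bitCoinv (reverse (marks a w))) (coinv (without a w)) ⟩
  bitCoinv (reverse (marks a w)) + coinv (x ∷ without a w)
    ≡⟨ ≡.cong₂ _+_ (bitCoinv-reverse-false (marks a w)) (≡.cong coinv (without-≢ w x≢a)) ⟨
  bitCoinv (reverse (false ∷ marks a w)) + coinv (without a (x ∷ w))
    ≡⟨ ≡.cong (λ b → bitCoinv (reverse b) + coinv (without a (x ∷ w))) (marks-≢ w x≢a) ⟨
  bitCoinv (reverse (marks a (x ∷ w))) + coinv (without a (x ∷ w)) ∎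
  where
  open ≡.≡-Reasoning
  shuffle : ∀ s t u → s + (t + u) ≡ t + (s + u)
  shuffle = solve-∀

-- The conditions on the pieces of a word

HasShape : ℕ → ℕ → Pred (List Bool) 0ℓ
HasShape x y b = trues b ≡ x × falses b ≡ y

hasShape? : ∀ x y → Decidable (HasShape x y)
hasShape? x y b = (trues b ≟ x) ×-dec (falses b ≟ y)

HasContent : (ℕ → ℕ) → List ℕ → Pred Word 0ℓ
HasContent α As w = All (λ i → count i w ≡ α i) As

hasContent? : ∀ α As → Decidable (HasContent α As)
hasContent? α As w = all? (λ i → count i w ≟ α i) As

HasContent-without : ∀ {α a} As w → All (_≢ a) As → HasContent α As (without a w) ⇔ HasContent α As w
HasContent-without {α} {a} As w As≢a = mk⇔
  (λ h → All.zipWith (λ (i≢a , eq) → ≡.trans (≡.sym (count-without w i≢a)) eq) (As≢a , h))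
  (λ h → All.zipWith (λ (i≢a , eq) → ≡.trans (count-without w i≢a) eq) (As≢a , h))

-- W_k with P imposed on the positions of the n's and Q on those of the 1's, the latter
-- counted from the right in the word without n's (hence the reversal).
Inner : (ℕ → ℕ) → List ℕ → Pred (List Bool) 0ℓ → ℕ → Pred Word 0ℓ
Inner α As Q c u = count 1 u ≡ c × Q (reverse (marks 1 u)) × HasContent α As (without 1 u)

inner? : ∀ α As {Q} → Decidable Q → ∀ c → Decidable (Inner α As Q c)
inner? α As Q? c u = (count 1 u ≟ c) ×-dec Q? (reverse (marks 1 u)) ×-dec hasContent? α As (without 1 u)

Outer : (ℕ → ℕ) → ℕ → List ℕ → (P Q : Pred (List Bool) 0ℓ) → ℕ → ℕ → Pred Word 0ℓ
Outer α n As P Q k c w = count n w ≡ k × P (marks n w) × Inner α As Q c (without n w)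

outer? : ∀ α n As {P Q} → Decidable P → Decidable Q → ∀ k c → Decidable (Outer α n As P Q k c)
outer? α n As P? Q? k c w = (count n w ≟ k) ×-dec P? (marks n w) ×-dec inner? α As Q? c (without n w)

-- The alphabet as a sorted list

[⋯⟩-∷ : ∀ m → [ 1 ⋯ suc (suc m) ⟩ ≡ 1 ∷ [ 2 ⋯ suc (suc m) ⟩
[⋯⟩-∷ m = ≡.cong (1 ∷_) (≡.trans (map-applyUpTo suc suc m) (≡.sym (map-upTo (2 +_) m)))

[⋯⟩-∷ʳ : ∀ {a b} → a ≤ b → [ a ⋯ suc b ⟩ ≡ [ a ⋯ b ⟩ ∷ʳ b
[⋯⟩-∷ʳ {a} {b} a≤b = begin
  map (a +_) (upTo (suc b ∸ a))          ≡⟨ ≡.cong (λ m → map (a +_) (upTo m)) (ℕₚ.+-∸-assoc 1 a≤b) ⟩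
  map (a +_) (upTo (suc (b ∸ a)))        ≡⟨ ≡.cong (map (a +_)) (upTo-∷ʳ (b ∸ a)) ⟨
  map (a +_) (upTo (b ∸ a) ∷ʳ (b ∸ a))   ≡⟨ map-++ (a +_) (upTo (b ∸ a)) _ ⟩
  [ a ⋯ b ⟩ ∷ʳ (a + (b ∸ a))             ≡⟨ ≡.cong ([ a ⋯ b ⟩ ∷ʳ_) (ℕₚ.m+[n∸m]≡n a≤b) ⟩
  [ a ⋯ b ⟩ ∷ʳ b ∎
  where open ≡.≡-Reasoning

alphabet : ∀ {n} → 2 ≤ n → [ 1 ⋯ suc n ⟩ ≡ (1 ∷ [ 2 ⋯ n ⟩) ∷ʳ n
alphabet {suc (suc m)} (s≤s (s≤s _)) = ≡.trans ([⋯⟩-∷ʳ (s≤s z≤n)) (≡.cong (_∷ʳ suc (suc m)) ([⋯⟩-∷ m))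

[⋯⟩-sorted : ∀ a b → AllPairs _<_ [ a ⋯ b ⟩
[⋯⟩-sorted a b = ≡.subst (AllPairs _<_) (≡.sym (map-upTo (a +_) (b ∸ a)))
  (AllPairs.applyUpTo⁺₁ (a +_) (b ∸ a) (λ i<j _ → ℕₚ.+-monoʳ-< a i<j))

[⋯⟩-lower : ∀ a b → All (a ≤_) [ a ⋯ b ⟩
[⋯⟩-lower a b = ≡.subst (All (a ≤_)) (≡.sym (map-upTo (a +_) (b ∸ a)))
  (All.applyUpTo⁺₂ (a +_) (b ∸ a) (ℕₚ.m≤m+n a))

[⋯⟩-upper : ∀ {a b} → a ≤ b → All (_< b) [ a ⋯ b ⟩
[⋯⟩-upper {a} {b} a≤b = ≡.subst (All (_< b)) (≡.sym (map-upTo (a +_) (b ∸ a)))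
  (All.applyUpTo⁺₁ (a +_) (b ∸ a) (λ i<b∸a →
    ≡.subst (a + _ <_) (ℕₚ.m+[n∸m]≡n a≤b) (ℕₚ.+-monoʳ-< a i<b∸a)))

-- Sums over words in a commutative semiring with a distinguished element q

module Sums {c ℓ : Level} (R : CommutativeSemiring c ℓ) (q : CommutativeSemiring.Carrier R) where

  open CommutativeSemiring R renaming (_+_ to _⊕_; _*_ to _⊛_)
  open import Algebra.Properties.Semiring.Exp semiring using (_^_; ^-homo-*; ^-congʳ)
  open import Algebra.Properties.CommutativeSemigroup +-commutativeSemigroup using () renaming (x∙yz≈y∙xz to x+[y+z]≈y+[x+z])
  open import Algebra.Solver.Ring.NaturalCoefficients.Default R using (solve; _:=_; _:+_; _:*_; con)
  open import Relation.Binary.Reasoning.Setoid setoid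

  infixr 7 _⇒_
  -- An Iverson bracket as a factor. Its argument is a Boolean rather than a decision, so only the
  -- equivalence of two predicates matters and not how they are decided.
  _⇒_ : Bool → Carrier → Carrier
  true  ⇒ x = x
  false ⇒ x = 0#

  ⇒-cong : ∀ {β γ x y} → β ≡ γ → x ≈ y → β ⇒ x ≈ γ ⇒ y
  ⇒-cong {true}  ≡.refl x≈y = x≈y
  ⇒-cong {false} ≡.refl x≈y = refl

  ⇒-∧ : ∀ β γ x y → (β ∧ γ) ⇒ (x ⊛ y) ≈ (β ⇒ x) ⊛ (γ ⇒ y)
  ⇒-∧ true  true  x y = refl
  ⇒-∧ true  false x y = sym (zeroʳ x)
  ⇒-∧ false γ     x y = sym (zeroˡ _)

  ⇒-* : ∀ β x y → β ⇒ (x ⊛ y) ≈ x ⊛ (β ⇒ y)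
  ⇒-* true  x y = refl
  ⇒-* false x y = sym (zeroʳ x)

  ∑ : {A : Set} → List A → (A → Carrier) → Carrier
  ∑ []       f = 0#
  ∑ (x ∷ xs) f = f x ⊕ ∑ xs f

  -- Recursion on the first letter replaces the explicit list of all words; removing a prescribed
  -- prefix is then an induction on the length.
  ∑ʷ : {A : Set} → List A → ℕ → (List A → Carrier) → Carrier
  ∑ʷ As zero    f = f []
  ∑ʷ As (suc N) f = ∑ As (λ a → ∑ʷ As N (λ w → f (a ∷ w)))

  module _ {A : Set} where

    ∑-cong : ∀ {xs : List A} {f g} → All (λ x → f x ≈ g x) xs → ∑ xs f ≈ ∑ xs g
    ∑-cong []       = refl
    ∑-cong (e ∷ es) = +-cong e (∑-cong es)

    ∑-cong′ : ∀ (xs : List A) {f g} → (∀ x → f x ≈ g x) → ∑ xs f ≈ ∑ xs g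
    ∑-cong′ xs e = ∑-cong (All.universal e xs)

    ∑-zero : ∀ (xs : List A) → ∑ xs (λ _ → 0#) ≈ 0#
    ∑-zero []       = refl
    ∑-zero (x ∷ xs) = trans (+-identityˡ _) (∑-zero xs)

    ∑-+ : ∀ (xs : List A) f g → ∑ xs (λ x → f x ⊕ g x) ≈ ∑ xs f ⊕ ∑ xs g
    ∑-+ []       f g = sym (+-identityˡ 0#)
    ∑-+ (x ∷ xs) f g = trans (+-congˡ (∑-+ xs f g))
      (solve 4 (λ a b c d → (a :+ b) :+ (c :+ d) := (a :+ c) :+ (b :+ d)) refl (f x) (g x) (∑ xs f) (∑ xs g))

    ∑-*ˡ : ∀ (xs : List A) c f → ∑ xs (λ x → c ⊛ f x) ≈ c ⊛ ∑ xs f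
    ∑-*ˡ []       c f = sym (zeroʳ c)
    ∑-*ˡ (x ∷ xs) c f = trans (+-congˡ (∑-*ˡ xs c f)) (sym (distribˡ c (f x) (∑ xs f)))

    ∑-∷ʳ : ∀ (xs : List A) x f → ∑ (xs ∷ʳ x) f ≈ f x ⊕ ∑ xs f
    ∑-∷ʳ []       x f = refl
    ∑-∷ʳ (y ∷ xs) x f = trans (+-congˡ (∑-∷ʳ xs x f)) (x+[y+z]≈y+[x+z] (f y) (f x) (∑ xs f))

    -- The pointwise hypothesis is restricted to words that actually occur, since splitting `coinv`
    -- requires a bound on the letters, and the number of remaining letters is known only from the
    -- length.
    ∑ʷ-congᴾ : ∀ {p} {P : Pred A p} {As} → All P As → ∀ N {f g} →
      (∀ w → All P w → length w ≡ N → f w ≈ g w) → ∑ʷ As N f ≈ ∑ʷ As N g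
    ∑ʷ-congᴾ ps zero    e = e [] [] ≡.refl
    ∑ʷ-congᴾ ps (suc N) e = ∑-cong (All.map
      (λ pa → ∑ʷ-congᴾ ps N (λ w pw len → e _ (pa ∷ pw) (≡.cong suc len))) ps)

    ∑ʷ-cong : ∀ (As : List A) N {f g} → (∀ w → f w ≈ g w) → ∑ʷ As N f ≈ ∑ʷ As N g
    ∑ʷ-cong As N e = ∑ʷ-congᴾ (All.universal {P = U} (λ _ → tt) As) N (λ w _ _ → e w)

    ∑ʷ-zero : ∀ (As : List A) N → ∑ʷ As N (λ _ → 0#) ≈ 0#
    ∑ʷ-zero As zero    = refl
    ∑ʷ-zero As (suc N) = trans (∑-cong′ As (λ _ → ∑ʷ-zero As N)) (∑-zero As)

    ∑ʷ-+ : ∀ (As : List A) N f g → ∑ʷ As N (λ w → f w ⊕ g w) ≈ ∑ʷ As N f ⊕ ∑ʷ As N g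
    ∑ʷ-+ As zero    f g = refl
    ∑ʷ-+ As (suc N) f g = trans (∑-cong′ As (λ a → ∑ʷ-+ As N (f ∘ (a ∷_)) (g ∘ (a ∷_)))) (∑-+ As _ _)

    ∑ʷ-*ˡ : ∀ (As : List A) N c f → ∑ʷ As N (λ w → c ⊛ f w) ≈ c ⊛ ∑ʷ As N f
    ∑ʷ-*ˡ As zero    c f = refl
    ∑ʷ-*ˡ As (suc N) c f = trans (∑-cong′ As (λ a → ∑ʷ-*ˡ As N c (f ∘ (a ∷_)))) (∑-*ˡ As c _)

    ∑ʷ-*ʳ : ∀ (As : List A) N c f → ∑ʷ As N (λ w → f w ⊛ c) ≈ ∑ʷ As N f ⊛ c
    ∑ʷ-*ʳ As N c f = trans (∑ʷ-cong As N (λ w → *-comm (f w) c)) (trans (∑ʷ-*ˡ As N c f) (*-comm _ _))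

    -- Brings n, the last letter of the alphabet, to the front, which is where a letter can be split
    -- off.
    ∑ʷ-∷ʳ : ∀ (As : List A) x N f → ∑ʷ (As ∷ʳ x) N f ≈ ∑ʷ (x ∷ As) N f
    ∑ʷ-∷ʳ As x zero    f = refl
    ∑ʷ-∷ʳ As x (suc N) f = trans (∑-cong′ (As ∷ʳ x) (λ a → ∑ʷ-∷ʳ As x N (f ∘ (a ∷_)))) (∑-∷ʳ As x _)

    ∑-∑ʷ-swap : ∀ {B : Set} (xs : List B) (As : List A) N (f : B → List A → Carrier) →
      ∑ xs (λ x → ∑ʷ As N (f x)) ≈ ∑ʷ As N (λ w → ∑ xs (λ x → f x w))
    ∑-∑ʷ-swap []       As N f = sym (∑ʷ-zero As N)
    ∑-∑ʷ-swap (x ∷ xs) As N f = trans (+-congˡ (∑-∑ʷ-swap xs As N f)) (sym (∑ʷ-+ As N _ _))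

    ∑ʷ-snoc : ∀ (As : List A) N f → ∑ʷ As (suc N) f ≈ ∑ʷ As N (λ w → ∑ As (λ a → f (w ∷ʳ a)))
    ∑ʷ-snoc As zero    f = refl
    ∑ʷ-snoc As (suc N) f = ∑-cong′ As (λ a → ∑ʷ-snoc As N (f ∘ (a ∷_)))

    -- Reversal turns the first letter into the last, and `∑ʷ-snoc` sums over the last letter
    -- separately.
    ∑ʷ-reverse : ∀ (As : List A) N f → ∑ʷ As N (f ∘ reverse) ≈ ∑ʷ As N f
    ∑ʷ-reverse As zero    f = refl
    ∑ʷ-reverse As (suc N) f = begin
      ∑ As (λ a → ∑ʷ As N (λ w → f (reverse (a ∷ w))))
        ≈⟨ ∑-cong′ As (λ a → ∑ʷ-cong As N (λ w → reflexive (≡.cong f (unfold-reverse a w)))) ⟩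
      ∑ As (λ a → ∑ʷ As N (λ w → f (reverse w ∷ʳ a)))
        ≈⟨ ∑-cong′ As (λ a → ∑ʷ-reverse As N (λ w → f (w ∷ʳ a))) ⟩
      ∑ As (λ a → ∑ʷ As N (λ w → f (w ∷ʳ a)))
        ≈⟨ ∑-∑ʷ-swap As As N (λ a w → f (w ∷ʳ a)) ⟩
      ∑ʷ As N (λ w → ∑ As (λ a → f (w ∷ʳ a)))
        ≈⟨ ∑ʷ-snoc As N f ⟨
      ∑ʷ As (suc N) f ∎

    ∑ʷ-none : ∀ (As : List A) N {p} {P : Pred (List A) p} (P? : Decidable P) (f : List A → Carrier) →
      (∀ w → ¬ P w) → ∑ʷ As N (λ w → does (P? w) ⇒ f w) ≈ 0#
    ∑ʷ-none As N P? f ¬P = trans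
      (∑ʷ-cong As N (λ w → ⇒-cong (dec-false (P? w) (¬P w)) refl)) (∑ʷ-zero As N)

  ∑-++ : ∀ {A : Set} (xs ys : List A) f → ∑ (xs ++ ys) f ≈ ∑ xs f ⊕ ∑ ys f
  ∑-++ []       ys f = sym (+-identityˡ _)
  ∑-++ (x ∷ xs) ys f = trans (+-congˡ (∑-++ xs ys f)) (sym (+-assoc _ _ _))

  ∑-map : ∀ {A B : Set} (g : A → B) xs f → ∑ (map g xs) f ≈ ∑ xs (f ∘ g)
  ∑-map g []       f = refl
  ∑-map g (x ∷ xs) f = +-congˡ (∑-map g xs f)

  ∑-cartesianProductWith : ∀ {A B C : Set} (h : A → B → C) xs ys f →
    ∑ (cartesianProductWith h xs ys) f ≈ ∑ xs (λ x → ∑ ys (λ y → f (h x y)))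
  ∑-cartesianProductWith h []       ys f = refl
  ∑-cartesianProductWith h (x ∷ xs) ys f = trans (∑-++ (map (h x) ys) _ f)
    (+-cong (∑-map (h x) ys f) (∑-cartesianProductWith h xs ys f))

  foldr-filter : ∀ {A : Set} {P : Pred A 0ℓ} (P? : Decidable P) (f : A → Carrier) xs →
    foldr _⊕_ 0# (map f (filter P? xs)) ≈ ∑ xs (λ x → does (P? x) ⇒ f x)
  foldr-filter P? f []       = refl
  foldr-filter P? f (x ∷ xs) with does (P? x)
  ... | true  = +-congˡ (foldr-filter P? f xs)
  ... | false = trans (foldr-filter P? f xs) (sym (+-identityˡ _))

  ∑-words : ∀ n N f → ∑ (words n N) f ≈ ∑ʷ [ 1 ⋯ suc n ⟩ N f
  ∑-words n zero    f = +-identityʳ _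
  ∑-words n (suc N) f = trans (∑-cartesianProductWith _∷_ [ 1 ⋯ suc n ⟩ (words n N) f)
    (∑-cong′ [ 1 ⋯ suc n ⟩ (λ a → ∑-words n N (f ∘ (a ∷_))))

  -- Factoring a sum over words along one letter

  bits : List Bool
  bits = true ∷ false ∷ []

  -- A word is the same as the positions of a together with the word of the other letters.
  ∑ʷ-split : ∀ {a As} → All (_≢ a) As → ∀ N (H : List Bool → Word → Carrier) →
    ∑ʷ (a ∷ As) N (λ w → H (marks a w) (without a w)) ≈ ∑ʷ bits N (λ b → ∑ʷ As (falses b) (H b))
  ∑ʷ-split                As≢a zero    H = refl
  ∑ʷ-split {a} {As} As≢a (suc N) H = +-cong
    (trans
      (∑ʷ-cong (a ∷ As) N (λ w → reflexive (≡.cong₂ H (marks-≡ a w) (without-≡ a w))))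
      (∑ʷ-split As≢a N (H ∘ (true ∷_))))
    (begin
      ∑ As (λ x → ∑ʷ (a ∷ As) N (λ w → H (marks a (x ∷ w)) (without a (x ∷ w))))
        ≈⟨ ∑-cong (All.map (λ x≢a → trans
             (∑ʷ-cong (a ∷ As) N (λ w → reflexive (≡.cong₂ H (marks-≢ w x≢a) (without-≢ w x≢a))))
             (∑ʷ-split As≢a N (λ b u → H (false ∷ b) (_ ∷ u)))) As≢a) ⟩
      ∑ As (λ x → ∑ʷ bits N (λ b → ∑ʷ As (falses b) (λ u → H (false ∷ b) (x ∷ u))))
        ≈⟨ ∑-∑ʷ-swap As bits N (λ x b → ∑ʷ As (falses b) (λ u → H (false ∷ b) (x ∷ u))) ⟩
      ∑ʷ bits N (λ b → ∑ʷ As (suc (falses b)) (H (false ∷ b)))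
        ≈⟨ +-identityʳ _ ⟨
      ∑ʷ bits N (λ b → ∑ʷ As (suc (falses b)) (H (false ∷ b))) ⊕ 0# ∎)

  bitSum : ∀ {P : Pred (List Bool) 0ℓ} → Decidable P → (N x y : ℕ) → Carrier
  bitSum P? N x y = ∑ʷ bits N (λ b → does (hasShape? x y b ×-dec P? b) ⇒ q ^ bitCoinv b)

  wordSum : ∀ {P : Pred Word 0ℓ} → Decidable P → List ℕ → ℕ → Carrier
  wordSum P? As N = ∑ʷ As N (λ w → does (P? w) ⇒ q ^ coinv w)

  wordSum-cong : ∀ {P Q : Pred Word 0ℓ} (P? : Decidable P) (Q? : Decidable Q) {Z : Pred ℕ 0ℓ} {As} →
    All Z As → ∀ N → (∀ w → All Z w → length w ≡ N → P w ⇔ Q w) → wordSum P? As N ≈ wordSum Q? As N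
  wordSum-cong P? Q? zs N e =
    ∑ʷ-congᴾ zs N (λ w zw len → ⇒-cong (does-⇔ (e w zw len) (P? w) (Q? w)) refl)

  -- ρ is the identity for the largest and the reversal for the smallest letter.
  extract : ∀ {P : Pred (List Bool) 0ℓ} {Q : Pred Word 0ℓ} (P? : Decidable P) (Q? : Decidable Q)
    (ρ : List Bool → List Bool) {Z : Pred ℕ 0ℓ} {a As} → All (_≢ a) As → All Z (a ∷ As) →
    (∀ w → All Z w → coinv w ≡ bitCoinv (ρ (marks a w)) + coinv (without a w)) → ∀ x y →
    wordSum (λ w → (count a w ≟ x) ×-dec P? (ρ (marks a w)) ×-dec Q? (without a w)) (a ∷ As) (x + y)
    ≈ ∑ʷ bits (x + y) (λ b → does (hasShape? x y b ×-dec P? (ρ b)) ⇒ q ^ bitCoinv (ρ b)) ⊛ wordSum Q? As y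
  extract {P} {Q} P? Q? ρ {Z} {a} {As} As≢a zs coinv≡ x y = begin
    wordSum D? (a ∷ As) (x + y)
      ≈⟨ ∑ʷ-congᴾ zs (x + y) pointwise ⟩
    ∑ʷ (a ∷ As) (x + y) (λ w → F (marks a w) ⊛ G (without a w))
      ≈⟨ ∑ʷ-split As≢a (x + y) (λ b u → F b ⊛ G u) ⟩
    ∑ʷ bits (x + y) (λ b → ∑ʷ As (falses b) (λ u → F b ⊛ G u))
      ≈⟨ ∑ʷ-cong bits (x + y) (λ b → trans (∑ʷ-*ˡ As (falses b) (F b) G) (support b)) ⟩
    ∑ʷ bits (x + y) (λ b → F b ⊛ ∑ʷ As y G)
      ≈⟨ ∑ʷ-*ʳ bits (x + y) (∑ʷ As y G) F ⟩
    ∑ʷ bits (x + y) F ⊛ ∑ʷ As y G ∎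
    where
    D? : Decidable (λ w → count a w ≡ x × P (ρ (marks a w)) × Q (without a w))
    D? w = (count a w ≟ x) ×-dec P? (ρ (marks a w)) ×-dec Q? (without a w)

    F : List Bool → Carrier
    F b = does (hasShape? x y b ×-dec P? (ρ b)) ⇒ q ^ bitCoinv (ρ b)

    G : Word → Carrier
    G u = does (Q? u) ⇒ q ^ coinv u

    shape : ∀ w → length w ≡ x + y → count a w ≡ x → HasShape x y (marks a w)
    shape w len eq = t , ℕₚ.+-cancelˡ-≡ x _ _ (≡.trans (≡.cong (_+ falses (marks a w)) (≡.sym t))
      (≡.trans (trues+falses (marks a w)) (≡.trans (length-map _ w) len)))
      where
      t : trues (marks a w) ≡ x
      t = ≡.trans (≡.sym (count-marks a w)) eq

    pointwise : ∀ w → All Z w → length w ≡ x + y →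
      does (D? w) ⇒ q ^ coinv w ≈ F (marks a w) ⊛ G (without a w)
    pointwise w zw len = trans
      (⇒-cong
        (does-⇔ (mk⇔ (λ (e , p , r) → (shape w len e , p) , r)
                     (λ (((e , _) , p) , r) → ≡.trans (count-marks a w) e , p , r))
          (D? w) ((hasShape? x y (marks a w) ×-dec P? (ρ (marks a w))) ×-dec Q? (without a w)))
        (trans (^-congʳ q (coinv≡ w zw)) (^-homo-* q (bitCoinv (ρ (marks a w))) (coinv (without a w)))))
      (⇒-∧ (does (hasShape? x y (marks a w) ×-dec P? (ρ (marks a w)))) (does (Q? (without a w))) _ _)

    -- The length of the remaining word depends on b, which prevents factoring. `HasShape` fixes the
    -- number of falses for this reason: where it is not y, the factor F b vanishes.
    support : ∀ b → F b ⊛ ∑ʷ As (falses b) G ≈ F b ⊛ ∑ʷ As y G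
    support b with falses b ≟ y
    ... | yes e = *-congˡ (reflexive (≡.cong (λ m → ∑ʷ As m G) e))
    ... | no ne = trans (*-congʳ F≈0) (trans (zeroˡ _) (sym (trans (*-congʳ F≈0) (zeroˡ _))))
      where
      F≈0 : F b ≈ 0#
      F≈0 = ⇒-cong (dec-false (hasShape? x y b ×-dec P? (ρ b)) (λ ((_ , e) , _) → ne e)) refl

  extract-max : ∀ {P : Pred (List Bool) 0ℓ} {Q : Pred Word 0ℓ} (P? : Decidable P) (Q? : Decidable Q)
    {a As} → All (_< a) As → ∀ x y →
    wordSum (λ w → (count a w ≟ x) ×-dec P? (marks a w) ×-dec Q? (without a w)) (a ∷ As) (x + y)
    ≈ bitSum P? (x + y) x y ⊛ wordSum Q? As y
  extract-max P? Q? As<a = extract P? Q? id (All.map ℕₚ.<⇒≢ As<a)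
    (ℕₚ.≤-refl ∷ All.map ℕₚ.<⇒≤ As<a) coinv-max

  -- The reversal sits both in the condition and in the exponent and preserves the shape, so summing
  -- over the reversed bits removes it.
  extract-min : ∀ {P : Pred (List Bool) 0ℓ} {Q : Pred Word 0ℓ} (P? : Decidable P) (Q? : Decidable Q)
    {a As} → All (a <_) As → ∀ x y →
    wordSum (λ w → (count a w ≟ x) ×-dec P? (reverse (marks a w)) ×-dec Q? (without a w)) (a ∷ As) (x + y)
    ≈ bitSum P? (x + y) x y ⊛ wordSum Q? As y
  extract-min P? Q? a<As x y = trans
    (extract P? Q? reverse (All.map ℕₚ.>⇒≢ a<As) (ℕₚ.≤-refl ∷ All.map ℕₚ.<⇒≤ a<As) coinv-min x y)
    (*-congʳ (trans
      (∑ʷ-cong bits (x + y) (λ b → ⇒-cong (does-⇔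
        (mk⇔ (λ ((t , f) , p) → (≡.trans (trues-reverse b) t , ≡.trans (falses-reverse b) f) , p)
             (λ ((t , f) , p) → (≡.trans (≡.sym (trues-reverse b)) t , ≡.trans (≡.sym (falses-reverse b)) f) , p))
        (hasShape? x y b ×-dec P? (reverse b)) (hasShape? x y (reverse b) ×-dec P? (reverse b))) refl))
      (∑ʷ-reverse bits (x + y) (λ b → does (hasShape? x y b ×-dec P? b) ⇒ q ^ bitCoinv b))))

  -- Binary words: recursion on the first bit, prescribed prefixes and q-binomials

  module _ {P : Pred (List Bool) 0ℓ} (P? : Decidable P) (N : ℕ) where

    bitSum-∷ : ∀ x y → bitSum P? (suc N) x y
      ≈ ∑ʷ bits N (λ b → does (hasShape? x y (true  ∷ b) ×-dec P? (true  ∷ b)) ⇒ q ^ bitCoinv b)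
      ⊕ ∑ʷ bits N (λ b → does (hasShape? x y (false ∷ b) ×-dec P? (false ∷ b)) ⇒ q ^ (trues b + bitCoinv b))
    bitSum-∷ x y = +-congˡ (+-identityʳ _)

    -- A leading false is in coinversion with each of the x trues behind it; on the support of the
    -- sum the exponent `trues b` is the constant x.
    bitSum-false : ∀ x y →
      ∑ʷ bits N (λ b → does (hasShape? x (suc y) (false ∷ b) ×-dec P? (false ∷ b)) ⇒ q ^ (trues b + bitCoinv b))
      ≈ q ^ x ⊛ bitSum (P? ∘ (false ∷_)) N x y
    bitSum-false x y = trans (∑ʷ-cong bits N pointwise) (∑ʷ-*ˡ bits N (q ^ x) _)
      where
      pointwise : ∀ b →
        does (hasShape? x y b ×-dec P? (false ∷ b)) ⇒ q ^ (trues b + bitCoinv b)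
        ≈ q ^ x ⊛ (does (hasShape? x y b ×-dec P? (false ∷ b)) ⇒ q ^ bitCoinv b)
      pointwise b with trues b ≟ x
      ... | yes ≡.refl = trans (⇒-cong {does (hasShape? x y b ×-dec P? (false ∷ b))} ≡.refl (^-homo-* q (trues b) (bitCoinv b)))
        (⇒-* (does (hasShape? x y b ×-dec P? (false ∷ b))) (q ^ x) (q ^ bitCoinv b))
      ... | no ne = trans (⇒-cong d≡false refl) (trans (sym (zeroʳ _)) (*-congˡ (sym (⇒-cong d≡false refl))))
        where
        d≡false : does (hasShape? x y b ×-dec P? (false ∷ b)) ≡ false
        d≡false = dec-false (hasShape? x y b ×-dec P? (false ∷ b)) (λ ((e , _) , _) → ne e)

    -- With P always true this is the q-Pascal recursion, according to the first bit.
    bitSum-suc-suc : ∀ x y → bitSum P? (suc N) (suc x) (suc y)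
      ≈ bitSum (P? ∘ (true ∷_)) N x (suc y) ⊕ q ^ suc x ⊛ bitSum (P? ∘ (false ∷_)) N (suc x) y
    bitSum-suc-suc x y = trans (bitSum-∷ (suc x) (suc y)) (+-congˡ (bitSum-false (suc x) y))

    bitSum-starts-true : (∀ b → ¬ (P (false ∷ b))) → ∀ x y →
      bitSum P? (suc N) (suc x) y ≈ bitSum (P? ∘ (true ∷_)) N x y
    bitSum-starts-true ¬P x y = trans (bitSum-∷ (suc x) y) (trans
      (+-congˡ (∑ʷ-none bits N (λ b → hasShape? (suc x) y (false ∷ b) ×-dec P? (false ∷ b)) (λ b → q ^ (trues b + bitCoinv b)) (λ b (_ , p) → ¬P b p)))
      (+-identityʳ _))

    bitSum-starts-false : (∀ b → ¬ (P (true ∷ b))) → ∀ x y →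
      bitSum P? (suc N) x (suc y) ≈ q ^ x ⊛ bitSum (P? ∘ (false ∷_)) N x y
    bitSum-starts-false ¬P x y = trans (bitSum-∷ x (suc y)) (trans
      (+-cong (∑ʷ-none bits N (λ b → hasShape? x (suc y) (true ∷ b) ×-dec P? (true ∷ b)) (λ b → q ^ bitCoinv b) (λ b (_ , p) → ¬P b p))
              (bitSum-false x y))
      (+-identityˡ _))

    bitSum-zero : ∀ y → bitSum P? (suc N) 0 (suc y) ≈ bitSum (P? ∘ (false ∷_)) N 0 y
    bitSum-zero y = trans (bitSum-∷ 0 (suc y)) (trans
      (+-cong (∑ʷ-none bits N (λ b → hasShape? 0 (suc y) (true ∷ b) ×-dec P? (true ∷ b)) (λ b → q ^ bitCoinv b) (λ { b ((() , _) , _) }))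
              (trans (bitSum-false 0 y) (*-identityˡ _)))
      (+-identityˡ _))

    bitSum-suc-zero : ∀ x → bitSum P? (suc N) (suc x) 0 ≈ bitSum (P? ∘ (true ∷_)) N x 0
    bitSum-suc-zero x = trans (bitSum-∷ (suc x) 0) (trans
      (+-congˡ (∑ʷ-none bits N (λ b → hasShape? (suc x) 0 (false ∷ b) ×-dec P? (false ∷ b)) (λ b → q ^ (trues b + bitCoinv b)) (λ { b ((_ , ()) , _) })))
      (+-identityʳ _))

  bitSum-cong : ∀ {P Q : Pred (List Bool) 0ℓ} (P? : Decidable P) (Q? : Decidable Q) N x y →
    (∀ b → P b ⇔ Q b) → bitSum P? N x y ≈ bitSum Q? N x y
  bitSum-cong P? Q? N x y e = ∑ʷ-cong bits N (λ b → ⇒-cong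
    (≡.cong (does (hasShape? x y b) ∧_) (does-⇔ (e b) (P? b) (Q? b))) refl)

  -- The generating function of all binary words with x trues and y falses. `q-binomial-fact` is
  -- what identifies it with the quotient of q-factorials.
  q-binomial : ℕ → ℕ → Carrier
  q-binomial x y = bitSum U? (x + y) x y

  -- The condition forces the first t bits to be false. Each precedes all x trues, and what follows
  -- is arbitrary.
  bitSum-<firstTrue : ∀ t x y →
    bitSum (λ b → t <? firstTrue b) (t + (x + y)) x (t + y) ≈ q ^ (t * x) ⊛ q-binomial x y
  bitSum-<firstTrue zero x y = trans
    (bitSum-cong (λ b → 0 <? firstTrue b) U? (x + y) x y (λ b → mk⇔ _ (λ _ → 0<firstTrue b)))
    (sym (*-identityˡ _))
  bitSum-<firstTrue (suc t) x y = begin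
    bitSum (λ b → suc t <? firstTrue b) (suc t + (x + y)) x (suc t + y)
      ≈⟨ bitSum-starts-false (λ b → suc t <? firstTrue b) (t + (x + y)) (λ { b (s≤s ()) }) x (t + y) ⟩
    q ^ x ⊛ bitSum (λ b → suc t <? suc (firstTrue b)) (t + (x + y)) x (t + y)
      ≈⟨ *-congˡ (bitSum-cong (λ b → suc t <? suc (firstTrue b)) (λ b → t <? firstTrue b) (t + (x + y)) x (t + y) (λ b → mk⇔ ℕ.s≤s⁻¹ s≤s)) ⟩
    q ^ x ⊛ bitSum (λ b → t <? firstTrue b) (t + (x + y)) x (t + y)
      ≈⟨ *-congˡ (bitSum-<firstTrue t x y) ⟩
    q ^ x ⊛ (q ^ (t * x) ⊛ q-binomial x y)
      ≈⟨ *-assoc _ _ _ ⟨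
    q ^ x ⊛ q ^ (t * x) ⊛ q-binomial x y
      ≈⟨ *-congʳ (^-homo-* q x (t * x)) ⟨
    q ^ (suc t * x) ⊛ q-binomial x y ∎

  -- Here t falses are followed by a prescribed true, which counts among the `suc x` trues that each
  -- of them precedes but adds no coinversion with what follows.
  bitSum-≡firstTrue : ∀ t x y →
    bitSum (λ b → firstTrue b ≟ suc t) (t + suc (x + y)) (suc x) (t + y) ≈ q ^ (t * suc x) ⊛ q-binomial x y
  bitSum-≡firstTrue zero x y = begin
    bitSum (λ b → firstTrue b ≟ 1) (suc (x + y)) (suc x) y
      ≈⟨ bitSum-starts-true (λ b → firstTrue b ≟ 1) (x + y)
           (λ b e → ℕₚ.>⇒≢ (0<firstTrue b) (ℕₚ.suc-injective e)) x y ⟩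
    bitSum (λ b → 1 ≟ 1) (x + y) x y
      ≈⟨ bitSum-cong (λ b → 1 ≟ 1) U? (x + y) x y (λ b → mk⇔ _ (λ _ → ≡.refl)) ⟩
    q-binomial x y
      ≈⟨ *-identityˡ _ ⟨
    1# ⊛ q-binomial x y ∎
  bitSum-≡firstTrue (suc t) x y = begin
    bitSum (λ b → firstTrue b ≟ suc (suc t)) (suc t + suc (x + y)) (suc x) (suc t + y)
      ≈⟨ bitSum-starts-false (λ b → firstTrue b ≟ suc (suc t)) (t + suc (x + y)) (λ { b () }) (suc x) (t + y) ⟩
    q ^ suc x ⊛ bitSum (λ b → suc (firstTrue b) ≟ suc (suc t)) (t + suc (x + y)) (suc x) (t + y)
      ≈⟨ *-congˡ (bitSum-cong (λ b → suc (firstTrue b) ≟ suc (suc t)) (λ b → firstTrue b ≟ suc t) (t + suc (x + y)) (suc x) (t + y)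
           (λ b → mk⇔ ℕₚ.suc-injective (≡.cong suc))) ⟩
    q ^ suc x ⊛ bitSum (λ b → firstTrue b ≟ suc t) (t + suc (x + y)) (suc x) (t + y)
      ≈⟨ *-congˡ (bitSum-≡firstTrue t x y) ⟩
    q ^ suc x ⊛ (q ^ (t * suc x) ⊛ q-binomial x y)
      ≈⟨ *-assoc _ _ _ ⟨
    q ^ suc x ⊛ q ^ (t * suc x) ⊛ q-binomial x y
      ≈⟨ *-congʳ (^-homo-* q (suc x) (t * suc x)) ⟨
    q ^ (suc t * suc x) ⊛ q-binomial x y ∎

  [_] : ℕ → Carrier
  [ zero  ] = 0#
  [ suc s ] = 1# ⊕ q ⊛ [ s ]

  fact : ℕ → Carrier
  fact zero    = 1#
  fact (suc m) = fact m ⊛ [ suc m ]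

  []-+ : ∀ x y → [ x + y ] ≈ [ x ] ⊕ q ^ x ⊛ [ y ]
  []-+ zero    y = sym (trans (+-identityˡ _) (*-identityˡ _))
  []-+ (suc x) y = trans (+-congˡ (*-congˡ ([]-+ x y)))
    (solve 4 (λ a b c d → con 1 :+ a :* (b :+ c :* d) := (con 1 :+ a :* b) :+ (a :* c) :* d) refl
      q [ x ] (q ^ x) [ y ])

  -- Induction along q-Pascal: by the two smaller cases the terms are the same q-factorial times
  -- [x + 1] and q^(x + 1) [y + 1], and `[]-+` adds these to [x + y + 2].
  q-binomial-fact : ∀ x y → q-binomial x y ⊛ (fact x ⊛ fact y) ≈ fact (x + y)
  q-binomial-fact zero zero = trans (*-identityˡ _) (*-identityˡ _)
  q-binomial-fact zero (suc y) = begin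
    q-binomial 0 (suc y) ⊛ (1# ⊛ (fact y ⊛ [ suc y ]))
      ≈⟨ *-congʳ (bitSum-zero U? y y) ⟩
    q-binomial 0 y ⊛ (1# ⊛ (fact y ⊛ [ suc y ]))
      ≈⟨ solve 3 (λ a b c → a :* (con 1 :* (b :* c)) := a :* (con 1 :* b) :* c) refl _ _ _ ⟩
    q-binomial 0 y ⊛ (1# ⊛ fact y) ⊛ [ suc y ]
      ≈⟨ *-congʳ (q-binomial-fact 0 y) ⟩
    fact y ⊛ [ suc y ] ∎
  q-binomial-fact (suc x) zero = begin
    q-binomial (suc x) 0 ⊛ (fact x ⊛ [ suc x ] ⊛ 1#)
      ≈⟨ *-congʳ (bitSum-suc-zero U? (x + 0) x) ⟩
    q-binomial x 0 ⊛ (fact x ⊛ [ suc x ] ⊛ 1#)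
      ≈⟨ solve 3 (λ a b c → a :* (b :* c :* con 1) := a :* (b :* con 1) :* c) refl _ _ _ ⟩
    q-binomial x 0 ⊛ (fact x ⊛ 1#) ⊛ [ suc x ]
      ≈⟨ *-congʳ (q-binomial-fact x 0) ⟩
    fact (x + 0) ⊛ [ suc x ]
      ≈⟨ *-congˡ (reflexive (≡.cong (λ m → [ suc m ]) (ℕₚ.+-identityʳ x))) ⟨
    fact (x + 0) ⊛ [ suc (x + 0) ] ∎
  q-binomial-fact (suc x) (suc y) = begin
    q-binomial (suc x) (suc y) ⊛ (fact (suc x) ⊛ fact (suc y))
      ≈⟨ *-congʳ (bitSum-suc-suc U? (x + suc y) x y) ⟩
    (q-binomial x (suc y) ⊕ q ^ suc x ⊛ bitSum U? (x + suc y) (suc x) y) ⊛ (fact (suc x) ⊛ fact (suc y))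
      ≈⟨ *-congʳ (+-congˡ (*-congˡ (reflexive (≡.cong (λ N → bitSum U? N (suc x) y) (ℕₚ.+-suc x y))))) ⟩
    (q-binomial x (suc y) ⊕ q ^ suc x ⊛ q-binomial (suc x) y) ⊛ (fact (suc x) ⊛ fact (suc y))
      ≈⟨ solve 7 (λ b c p f g s r →
           (b :+ p :* c) :* ((f :* s) :* (g :* r)) :=
           (b :* (f :* (g :* r))) :* s :+ (c :* ((f :* s) :* g)) :* (p :* r)) refl
           (q-binomial x (suc y)) (q-binomial (suc x) y) (q ^ suc x) (fact x) (fact y) [ suc x ] [ suc y ] ⟩
    (q-binomial x (suc y) ⊛ (fact x ⊛ fact (suc y))) ⊛ [ suc x ]
      ⊕ (q-binomial (suc x) y ⊛ (fact (suc x) ⊛ fact y)) ⊛ (q ^ suc x ⊛ [ suc y ])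
      ≈⟨ +-cong (*-congʳ (q-binomial-fact x (suc y))) (*-congʳ (q-binomial-fact (suc x) y)) ⟩
    fact (x + suc y) ⊛ [ suc x ] ⊕ fact (suc x + y) ⊛ (q ^ suc x ⊛ [ suc y ])
      ≈⟨ +-congˡ (*-congʳ (reflexive (≡.cong fact (ℕₚ.+-suc x y)))) ⟨
    fact (x + suc y) ⊛ [ suc x ] ⊕ fact (x + suc y) ⊛ (q ^ suc x ⊛ [ suc y ])
      ≈⟨ distribˡ _ _ _ ⟨
    fact (x + suc y) ⊛ ([ suc x ] ⊕ q ^ suc x ⊛ [ suc y ])
      ≈⟨ *-congˡ ([]-+ (suc x) (suc y)) ⟨
    fact (suc x + suc y) ∎

  -- MacMahon's formula for words of given content

  ∏ : List Carrier → Carrier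
  ∏ = foldr _⊛_ 1#

  module _ (α : ℕ → ℕ) where

    size : List ℕ → ℕ
    size As = sum (map α As)

    contentSum : List ℕ → Carrier
    contentSum As = wordSum (hasContent? α As) As (size As)

    -- The head of a sorted alphabet is its smallest letter. Extracting it leaves a q-binomial times
    -- the sum over the other letters, and the q-factorial of their total number cancels in
    -- `q-binomial-fact`.
    macMahon : ∀ {As} → AllPairs _<_ As → contentSum As ⊛ ∏ (map (fact ∘ α) As) ≈ fact (size As)
    macMahon                []            = *-identityˡ _
    macMahon {a ∷ As} (a<As ∷ sorted) = begin
      contentSum (a ∷ As) ⊛ (fact (α a) ⊛ ∏ (map (fact ∘ α) As))
        ≈⟨ *-congʳ (wordSum-cong (hasContent? α (a ∷ As)) D? (All.universal {P = U} (λ _ → tt) (a ∷ As)) (size (a ∷ As)) (λ w _ _ → content w)) ⟩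
      wordSum D? (a ∷ As) (size (a ∷ As)) ⊛ (fact (α a) ⊛ ∏ (map (fact ∘ α) As))
        ≈⟨ *-congʳ (extract-min U? (hasContent? α As) a<As (α a) (size As)) ⟩
      q-binomial (α a) (size As) ⊛ contentSum As ⊛ (fact (α a) ⊛ ∏ (map (fact ∘ α) As))
        ≈⟨ solve 4 (λ b c f p → b :* c :* (f :* p) := b :* (f :* (c :* p))) refl _ _ _ _ ⟩
      q-binomial (α a) (size As) ⊛ (fact (α a) ⊛ (contentSum As ⊛ ∏ (map (fact ∘ α) As)))
        ≈⟨ *-congˡ (*-congˡ (macMahon sorted)) ⟩
      q-binomial (α a) (size As) ⊛ (fact (α a) ⊛ fact (size As))
        ≈⟨ q-binomial-fact (α a) (size As) ⟩
      fact (size (a ∷ As)) ∎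
      where
      open Equivalence
      As≢a : All (_≢ a) As
      As≢a = All.map ℕₚ.>⇒≢ a<As

      D : Pred Word 0ℓ
      D w = count a w ≡ α a × U (reverse (marks a w)) × HasContent α As (without a w)

      D? : Decidable D
      D? w = (count a w ≟ α a) ×-dec U? (reverse (marks a w)) ×-dec hasContent? α As (without a w)

      content : ∀ w → HasContent α (a ∷ As) w ⇔ D w
      content w = mk⇔
        (λ { (e ∷ es) → e , tt , from (HasContent-without As w As≢a) es })
        (λ (e , _ , es) → e ∷ to (HasContent-without As w As≢a) es)

  -- The two constrained sums as products

  module _ (α : ℕ → ℕ) {n : ℕ} {As : List ℕ} (sorted : AllPairs _<_ As) (1<As : All (1 <_) As) (<n : All (_< n) (1 ∷ As)) where

    M : ℕ
    M = size α As

    wordSum-outer : ∀ {P Q} (P? : Decidable P) (Q? : Decidable Q) k c →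
      wordSum (outer? α n As P? Q? k c) (n ∷ 1 ∷ As) (k + (c + M))
      ≈ bitSum P? (k + (c + M)) k (c + M) ⊛ (bitSum Q? (c + M) c M ⊛ contentSum α As)
    wordSum-outer P? Q? k c = trans (extract-max P? (inner? α As Q? c) <n k (c + M))
      (*-congˡ (extract-min Q? (hasContent? α As) 1<As c M))

    -- The second factor is, bracket by bracket, the denominator of the right-hand side of the
    -- theorem: `1#` belongs to the power of q, the product to the multinomial in α, the rest to the
    -- trinomial with entries k, y, x.
    q-trinomial-fact : ∀ k x y →
      q-binomial k (x + y) ⊛ (q-binomial x y ⊛ contentSum α As)
        ⊛ ((1# ⊛ ∏ (map (fact ∘ α) As)) ⊛ (fact k ⊛ (fact y ⊛ (fact x ⊛ 1#))))
      ≈ fact M ⊛ fact (k + (x + y))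
    q-trinomial-fact k x y = begin
      q-binomial k (x + y) ⊛ (q-binomial x y ⊛ contentSum α As)
        ⊛ ((1# ⊛ ∏ (map (fact ∘ α) As)) ⊛ (fact k ⊛ (fact y ⊛ (fact x ⊛ 1#))))
        ≈⟨ solve 7 (λ b d s p f g h →
             b :* (d :* s) :* ((con 1 :* p) :* (f :* (g :* (h :* con 1)))) :=
             (s :* p) :* (b :* (f :* (d :* (h :* g))))) refl
             (q-binomial k (x + y)) (q-binomial x y) (contentSum α As) (∏ (map (fact ∘ α) As)) (fact k) (fact y) (fact x) ⟩
      (contentSum α As ⊛ ∏ (map (fact ∘ α) As)) ⊛ (q-binomial k (x + y) ⊛ (fact k ⊛ (q-binomial x y ⊛ (fact x ⊛ fact y))))
        ≈⟨ *-cong (macMahon α sorted) (*-congˡ (*-congˡ (q-binomial-fact x y))) ⟩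
      fact M ⊛ (q-binomial k (x + y) ⊛ (fact k ⊛ fact (x + y)))
        ≈⟨ *-congˡ (q-binomial-fact k (x + y)) ⟩
      fact M ⊛ fact (k + (x + y)) ∎

    -- Here i = t + 1 and L = k + x + 1. The positions of n lose i falses; those of 1, read from the
    -- right, lose t falses and one true. Either way x + y letters other than n remain.
    wordSum-greater : ∀ k x t y → M ≡ t + y →
      wordSum (outer? α n As (λ b → suc t <? firstTrue b) (λ b → firstTrue b ≟ suc t) k (suc x)) (n ∷ 1 ∷ As) (k + (suc x + M))
      ≈ q ^ (k + t * (k + suc x)) ⊛ (q-binomial k (x + y) ⊛ (q-binomial x y ⊛ contentSum α As))
    wordSum-greater k x t y M≡ = begin
      wordSum (outer? α n As P? Q? k (suc x)) (n ∷ 1 ∷ As) (k + (suc x + M))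
        ≈⟨ wordSum-outer P? Q? k (suc x) ⟩
      bitSum P? (k + (suc x + M)) k (suc x + M) ⊛ (bitSum Q? (suc x + M) (suc x) M ⊛ contentSum α As)
        ≈⟨ *-cong
             (reflexive (≡.cong₂ (λ N → bitSum P? N k)
               (≡.trans (≡.cong (λ m → k + (suc x + m)) M≡) (e₁ k x t y))
               (≡.trans (≡.cong (suc x +_) M≡) (e₂ x t y))))
             (*-congʳ (reflexive (≡.cong₂ (λ N → bitSum Q? N (suc x))
               (≡.trans (≡.cong (suc x +_) M≡) (e₃ x t y)) M≡))) ⟩
      bitSum P? (suc t + (k + (x + y))) k (suc t + (x + y))
        ⊛ (bitSum Q? (t + suc (x + y)) (suc x) (t + y) ⊛ contentSum α As)
        ≈⟨ *-cong (bitSum-<firstTrue (suc t) k (x + y)) (*-congʳ (bitSum-≡firstTrue t x y)) ⟩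
      q ^ (suc t * k) ⊛ q-binomial k (x + y) ⊛ (q ^ (t * suc x) ⊛ q-binomial x y ⊛ contentSum α As)
        ≈⟨ solve 5 (λ p b r d s → p :* b :* (r :* d :* s) := p :* r :* (b :* (d :* s))) refl _ _ _ _ _ ⟩
      q ^ (suc t * k) ⊛ q ^ (t * suc x) ⊛ (q-binomial k (x + y) ⊛ (q-binomial x y ⊛ contentSum α As))
        ≈⟨ *-congʳ (trans (sym (^-homo-* q (suc t * k) (t * suc x))) (^-congʳ q (e₄ k x t))) ⟩
      q ^ (k + t * (k + suc x)) ⊛ (q-binomial k (x + y) ⊛ (q-binomial x y ⊛ contentSum α As)) ∎
      where
      P? : Decidable (λ b → suc t < firstTrue b)
      P? b = suc t <? firstTrue b

      Q? : Decidable (λ b → firstTrue b ≡ suc t)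
      Q? b = firstTrue b ≟ suc t

      e₁ : ∀ k x t y → k + (suc x + (t + y)) ≡ suc t + (k + (x + y))
      e₁ = solve-∀
      e₂ : ∀ x t y → suc x + (t + y) ≡ suc t + (x + y)
      e₂ = solve-∀
      e₃ : ∀ x t y → suc x + (t + y) ≡ t + suc (x + y)
      e₃ = solve-∀
      e₄ : ∀ k x t → suc t * k + t * suc x ≡ k + t * (k + suc x)
      e₄ = solve-∀

    -- Here j = t + 1 and L = k + 1 + x. The positions of n lose t falses and the first n, those of
    -- 1 lose t falses; since t < p₁ means j ≤ p₁, no 1 is removed.
    wordSum-atMost : ∀ k x t y → M ≡ t + y →
      wordSum (outer? α n As (λ b → firstTrue b ≟ suc t) (λ b → t <? firstTrue b) (suc k) x) (n ∷ 1 ∷ As) (suc k + (x + M))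
      ≈ q ^ (t * (suc k + x)) ⊛ (q-binomial k (x + y) ⊛ (q-binomial x y ⊛ contentSum α As))
    wordSum-atMost k x t y M≡ = begin
      wordSum (outer? α n As P? Q? (suc k) x) (n ∷ 1 ∷ As) (suc k + (x + M))
        ≈⟨ wordSum-outer P? Q? (suc k) x ⟩
      bitSum P? (suc k + (x + M)) (suc k) (x + M) ⊛ (bitSum Q? (x + M) x M ⊛ contentSum α As)
        ≈⟨ *-cong
             (reflexive (≡.cong₂ (λ N → bitSum P? N (suc k))
               (≡.trans (≡.cong (λ m → suc k + (x + m)) M≡) (e₁ k x t y))
               (≡.trans (≡.cong (x +_) M≡) (e₂ x t y))))
             (*-congʳ (reflexive (≡.cong₂ (λ N → bitSum Q? N x)
               (≡.trans (≡.cong (x +_) M≡) (e₂ x t y)) M≡))) ⟩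
      bitSum P? (t + suc (k + (x + y))) (suc k) (t + (x + y))
        ⊛ (bitSum Q? (t + (x + y)) x (t + y) ⊛ contentSum α As)
        ≈⟨ *-cong (bitSum-≡firstTrue t k (x + y)) (*-congʳ (bitSum-<firstTrue t x y)) ⟩
      q ^ (t * suc k) ⊛ q-binomial k (x + y) ⊛ (q ^ (t * x) ⊛ q-binomial x y ⊛ contentSum α As)
        ≈⟨ solve 5 (λ p b r d s → p :* b :* (r :* d :* s) := p :* r :* (b :* (d :* s))) refl _ _ _ _ _ ⟩
      q ^ (t * suc k) ⊛ q ^ (t * x) ⊛ (q-binomial k (x + y) ⊛ (q-binomial x y ⊛ contentSum α As))
        ≈⟨ *-congʳ (trans (sym (^-homo-* q (t * suc k) (t * x))) (^-congʳ q (≡.sym (ℕₚ.*-distribˡ-+ t (suc k) x)))) ⟩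
      q ^ (t * (suc k + x)) ⊛ (q-binomial k (x + y) ⊛ (q-binomial x y ⊛ contentSum α As)) ∎
      where
      P? : Decidable (λ b → firstTrue b ≡ suc t)
      P? b = firstTrue b ≟ suc t

      Q? : Decidable (λ b → t < firstTrue b)
      Q? b = t <? firstTrue b

      e₁ : ∀ k x t y → suc k + (x + (t + y)) ≡ t + suc (k + (x + y))
      e₁ = solve-∀
      e₂ : ∀ x t y → x + (t + y) ≡ t + (x + y)
      e₂ = solve-∀

-- The words of the theorem

module Reduction (n : ℕ) (α : ℕ → ℕ) (N ℓ : ℕ) (2<n : 2 < n) (∣α∣<N : Setup.∣α∣ n α N ℓ < N) where

  open Setup n α N ℓ

  middle : List ℕ
  middle = [ 2 ⋯ n ⟩

  1≢n : 1 ≢ n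
  1≢n = ℕₚ.<⇒≢ (ℕₚ.<-trans (ℕₚ.n<1+n 1) 2<n)

  ∣α∣+L≡N : ∣α∣ + L ≡ N
  ∣α∣+L≡N = ℕₚ.m+[n∸m]≡n (ℕₚ.<⇒≤ ∣α∣<N)

  length-without : ∀ a w → count a w + length (without a w) ≡ length w
  length-without a w = ≡.trans (≡.cong₂ _+_ (count-marks a w) (≡.sym (falses-marks a w)))
    (≡.trans (trues+falses (marks a w)) (length-map _ w))

  p₁≡ : ∀ w → p₁ w ≡ firstTrue (reverse (marks 1 (without n w)))
  p₁≡ w = position-reverse 1 (without n w)

  W⇔ : ∀ k w → W k w ⇔
    (count n w ≡ k × count 1 (without n w) ≡ L ∸ k × HasContent α middle (without 1 (without n w)))
  W⇔ k w = mk⇔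
    (λ (e , e₁ , es) → e , ≡.trans (count-without w 1≢n) e₁ ,
      from (HasContent-without middle (without n w) ≢1) (from (HasContent-without middle w ≢n) es))
    (λ (e , e₁ , es) → e , ≡.trans (≡.sym (count-without w 1≢n)) e₁ ,
      to (HasContent-without middle w ≢n) (to (HasContent-without middle (without n w) ≢1) es))
    where
    open Equivalence
    ≢1 : All (_≢ 1) middle
    ≢1 = All.map ℕₚ.>⇒≢ ([⋯⟩-lower 2 n)
    ≢n : All (_≢ n) middle
    ≢n = All.map ℕₚ.<⇒≢ ([⋯⟩-upper (ℕₚ.<⇒≤ 2<n))

  -- Substituting p₁ = i into the comparison makes it a condition on the positions of n. The bound
  -- on t makes this agree with the convention for k = 0.
  W>⇔ : ∀ k x t → L ≡ k + suc x → t ≤ ∣α∣ → ∀ w → length w ≡ N →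
    (W> k w × p₁ w ≡ suc t) ⇔
    Outer α n middle (λ b → suc t < firstTrue b) (λ b → firstTrue b ≡ suc t) k (suc x) w
  W>⇔ k x t L≡ t≤ w len = mk⇔ to′ from′
    where
    open Equivalence (W⇔ k w)
    L∸k : L ∸ k ≡ suc x
    L∸k = ≡.trans (≡.cong (_∸ k) L≡) (ℕₚ.m+n∸m≡n k (suc x))

    pₙ> : count n w ≡ k → p₁ w ≡ suc t → k ≡ 0 ⊎ (k ≢ L × p₁ w < pₙ w) → suc t < firstTrue (marks n w)
    pₙ> cₙ p₁≡t (inj₂ (_ , p₁<pₙ)) = ≡.subst₂ _<_ p₁≡t (position-marks n w) p₁<pₙ
    -- Without any n the junk value is N + 1, which exceeds i = t + 1 because t ≤ |α| < N.
    pₙ> cₙ p₁≡t (inj₁ k≡0) = ≡.subst (suc t <_) (≡.sym (firstTrue-none (marks n w) no-n))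
      (s≤s (≡.subst (t <_) (≡.sym all-false) (ℕₚ.≤-<-trans t≤ ∣α∣<N)))
      where
      no-n : trues (marks n w) ≡ 0
      no-n = ≡.trans (≡.sym (count-marks n w)) (≡.trans cₙ k≡0)
      all-false : falses (marks n w) ≡ N
      all-false = ≡.trans (≡.cong (_+ falses (marks n w)) (≡.sym no-n))
        (≡.trans (trues+falses (marks n w)) (≡.trans (length-map _ w) len))

    to′ : W> k w × p₁ w ≡ suc t → Outer α n middle (λ b → suc t < firstTrue b) (λ b → firstTrue b ≡ suc t) k (suc x) w
    to′ ((Wkw , cmp) , p₁≡t) with to Wkw
    ... | cₙ , c₁ , content =
      cₙ , pₙ> cₙ p₁≡t cmp , ≡.trans c₁ L∸k , ≡.trans (≡.sym (p₁≡ w)) p₁≡t , content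

    from′ : Outer α n middle (λ b → suc t < firstTrue b) (λ b → firstTrue b ≡ suc t) k (suc x) w → W> k w × p₁ w ≡ suc t
    from′ (cₙ , t<pₙ , c₁ , p≡t , content) =
      ( from (cₙ , ≡.trans c₁ (≡.sym L∸k) , content)
      , inj₂ (k≢L , ≡.subst₂ _<_ (≡.sym p₁≡t) (≡.sym (position-marks n w)) t<pₙ)) , p₁≡t
      where
      p₁≡t : p₁ w ≡ suc t
      p₁≡t = ≡.trans (p₁≡ w) p≡t
      k≢L : k ≢ L
      k≢L k≡L = ℕₚ.m≢1+m+n k (≡.trans k≡L (≡.trans L≡ (ℕₚ.+-suc k x)))

  -- Now pₙ = j is substituted, leaving a condition on the positions of 1; the bound on t covers the
  -- convention for k = L.
  W≤⇔ : ∀ k x t → L ≡ suc k + x → t ≤ ∣α∣ → ∀ w → length w ≡ N →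
    (W≤ (suc k) w × pₙ w ≡ suc t) ⇔
    Outer α n middle (λ b → firstTrue b ≡ suc t) (λ b → t < firstTrue b) (suc k) x w
  W≤⇔ k x t L≡ t≤ w len = mk⇔ to′ from′
    where
    open Equivalence (W⇔ (suc k) w)
    u : Word
    u = without n w

    L∸k : L ∸ suc k ≡ x
    L∸k = ≡.trans (≡.cong (_∸ suc k) L≡) (ℕₚ.m+n∸m≡n (suc k) x)

    p₁≥ : count n w ≡ suc k → count 1 u ≡ L ∸ suc k → pₙ w ≡ suc t →
      suc k ≡ L ⊎ (suc k ≢ 0 × pₙ w ≤ p₁ w) → t < firstTrue (reverse (marks 1 u))
    p₁≥ cₙ c₁ pₙ≡t (inj₂ (_ , pₙ≤p₁)) = ≡.subst₂ _≤_ pₙ≡t (p₁≡ w) pₙ≤p₁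
    -- Without any 1 the word `u` consists of the |α| middle letters, so the junk value is |α| + 1,
    -- at least j = t + 1.
    p₁≥ cₙ c₁ pₙ≡t (inj₁ k≡L) = ≡.subst (t <_) (≡.sym (firstTrue-none (reverse (marks 1 u)) no-1))
      (s≤s (≡.subst (t ≤_) (≡.sym all-false) t≤))
      where
      no-1′ : count 1 u ≡ 0
      no-1′ = ≡.trans c₁ (≡.trans (≡.cong (L ∸_) k≡L) (ℕₚ.n∸n≡0 L))
      no-1 : trues (reverse (marks 1 u)) ≡ 0
      no-1 = ≡.trans (trues-reverse (marks 1 u)) (≡.trans (≡.sym (count-marks 1 u)) no-1′)
      length-u : length u ≡ ∣α∣
      length-u = ℕₚ.+-cancelˡ-≡ L _ _ (≡.trans (≡.cong (_+ length u) (≡.sym (≡.trans cₙ k≡L)))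
        (≡.trans (length-without n w) (≡.trans len (≡.trans (≡.sym ∣α∣+L≡N) (ℕₚ.+-comm ∣α∣ L)))))
      all-false : falses (reverse (marks 1 u)) ≡ ∣α∣
      all-false = ≡.trans (falses-reverse (marks 1 u)) (≡.trans (falses-marks 1 u)
        (≡.trans (≡.cong (_+ length (without 1 u)) (≡.sym no-1′)) (≡.trans (length-without 1 u) length-u)))

    to′ : W≤ (suc k) w × pₙ w ≡ suc t → Outer α n middle (λ b → firstTrue b ≡ suc t) (λ b → t < firstTrue b) (suc k) x w
    to′ ((Wkw , cmp) , pₙ≡t) with to Wkw
    ... | cₙ , c₁ , content =
      cₙ , ≡.trans (≡.sym (position-marks n w)) pₙ≡t , ≡.trans c₁ L∸k , p₁≥ cₙ c₁ pₙ≡t cmp , content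

    from′ : Outer α n middle (λ b → firstTrue b ≡ suc t) (λ b → t < firstTrue b) (suc k) x w → W≤ (suc k) w × pₙ w ≡ suc t
    from′ (cₙ , p≡t , c₁ , t<p₁ , content) =
      ( from (cₙ , ≡.trans c₁ (≡.sym L∸k) , content)
      , inj₂ ((λ ()) , ≡.subst₂ _≤_ (≡.sym pₙ≡t) (≡.sym (p₁≡ w)) t<p₁)) , pₙ≡t
      where
      pₙ≡t : pₙ w ≡ suc t
      pₙ≡t = ≡.trans (position-marks n w) p≡t

  -- The sums of quinv′ over a commutative semiring

  module _ {c r : Level} (R : CommutativeSemiring c r) (q : CommutativeSemiring.Carrier R) where

    open CommutativeSemiring R renaming (_+_ to _⊕_; _*_ to _⊛_)
    open import Algebra.Properties.Semiring.Exp semiring using (_^_; ^-homo-*; ^-congʳ)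
    open import Relation.Binary.Reasoning.Setoid setoid
    open Sums R q

    quinvSum : ℕ → {P : Pred Word 0ℓ} → Decidable P → Carrier
    quinvSum k P? = foldr _⊕_ 0# (map (λ w → q ^ quinv′ k w) (filter P? (words n N)))

    quinvSum≈wordSum : ∀ k {P : Pred Word 0ℓ} (P? : Decidable P) →
      quinvSum k P? ≈ q ^ (binomials + k C 2) ⊛ wordSum P? (n ∷ 1 ∷ middle) N
    quinvSum≈wordSum k P? = begin
      quinvSum k P?
        ≈⟨ foldr-filter P? (λ w → q ^ quinv′ k w) (words n N) ⟩
      ∑ (words n N) (λ w → does (P? w) ⇒ q ^ quinv′ k w)
        ≈⟨ ∑-words n N _ ⟩
      ∑ʷ [ 1 ⋯ suc n ⟩ N (λ w → does (P? w) ⇒ q ^ quinv′ k w)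
        ≈⟨ reflexive (≡.cong (λ As → ∑ʷ As N (λ w → does (P? w) ⇒ q ^ quinv′ k w)) (alphabet (ℕₚ.<⇒≤ 2<n))) ⟩
      ∑ʷ ((1 ∷ middle) ∷ʳ n) N (λ w → does (P? w) ⇒ q ^ quinv′ k w)
        ≈⟨ ∑ʷ-∷ʳ (1 ∷ middle) n N _ ⟩
      ∑ʷ (n ∷ 1 ∷ middle) N (λ w → does (P? w) ⇒ q ^ quinv′ k w)
        ≈⟨ ∑ʷ-cong (n ∷ 1 ∷ middle) N (λ w → trans
             (⇒-cong {does (P? w)} ≡.refl (trans (^-congʳ q (shuffle (coinv w) binomials (k C 2)))
               (^-homo-* q (binomials + k C 2) (coinv w))))
             (⇒-* (does (P? w)) (q ^ (binomials + k C 2)) (q ^ coinv w))) ⟩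
      ∑ʷ (n ∷ 1 ∷ middle) N (λ w → q ^ (binomials + k C 2) ⊛ (does (P? w) ⇒ q ^ coinv w))
        ≈⟨ ∑ʷ-*ˡ (n ∷ 1 ∷ middle) N (q ^ (binomials + k C 2)) (λ w → does (P? w) ⇒ q ^ coinv w) ⟩
      q ^ (binomials + k C 2) ⊛ wordSum P? (n ∷ 1 ∷ middle) N ∎
      where
      shuffle : ∀ c b d → c + b + d ≡ b + d + c
      shuffle = solve-∀

    1<middle : All (1 <_) middle
    1<middle = [⋯⟩-lower 2 n

    <n : All (_< n) (1 ∷ middle)
    <n = ℕₚ.<-trans (ℕₚ.n<1+n 1) 2<n ∷ [⋯⟩-upper (ℕₚ.<⇒≤ 2<n)

    -- The conclusion is the cross-multiplied equation of fractions, its final `1#` being the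
    -- denominator of `⟦_⟧`. The exponent d comes from the binomials in quinv′, and e from the
    -- prescribed ends.
    multiplyOut : ∀ {S X E} d e k x y → S ≈ q ^ d ⊛ X →
      X ≈ q ^ e ⊛ (q-binomial k (x + y) ⊛ (q-binomial x y ⊛ contentSum α middle)) → d + e ≡ E →
      S ⊛ ((1# ⊛ ∏ (map (fact ∘ α) middle)) ⊛ (fact k ⊛ (fact y ⊛ (fact x ⊛ 1#))))
      ≈ q ^ E ⊛ fact ∣α∣ ⊛ fact (k + (x + y)) ⊛ 1#
    multiplyOut {S} {X} {E} d e k x y S≈ X≈ ≡.refl = begin
      S ⊛ Z
        ≈⟨ *-congʳ (trans S≈ (trans (*-congˡ X≈) (sym (*-assoc _ _ _)))) ⟩
      q ^ d ⊛ q ^ e ⊛ Y ⊛ Z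
        ≈⟨ *-assoc _ _ _ ⟩
      q ^ d ⊛ q ^ e ⊛ (Y ⊛ Z)
        ≈⟨ *-cong (sym (^-homo-* q d e)) (q-trinomial-fact α ([⋯⟩-sorted 2 n) 1<middle <n k x y) ⟩
      q ^ (d + e) ⊛ (fact ∣α∣ ⊛ fact (k + (x + y)))
        ≈⟨ trans (sym (*-assoc _ _ _)) (sym (*-identityʳ _)) ⟩
      q ^ (d + e) ⊛ fact ∣α∣ ⊛ fact (k + (x + y)) ⊛ 1# ∎
      where
      Y Z : Carrier
      Y   = q-binomial k (x + y) ⊛ (q-binomial x y ⊛ contentSum α middle)
      Z = (1# ⊛ ∏ (map (fact ∘ α) middle)) ⊛ (fact k ⊛ (fact y ⊛ (fact x ⊛ 1#)))

    N≡ : ∀ k c → L ≡ k + c → N ≡ k + (c + ∣α∣)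
    N≡ k c L≡ = ≡.trans (≡.sym ∣α∣+L≡N) (≡.trans (≡.cong (∣α∣ +_) L≡) (shuffle ∣α∣ k c))
      where
      shuffle : ∀ m k c → m + (k + c) ≡ k + (c + m)
      shuffle = solve-∀

    quinvSum-greater : ∀ k x t y → L ≡ k + suc x → ∣α∣ ≡ t + y →
      quinvSum k (λ w → W>? k w ×-dec (p₁ w ≟ suc t))
        ⊛ ((1# ⊛ ∏ (map (fact ∘ α) middle)) ⊛ (fact k ⊛ (fact y ⊛ (fact x ⊛ 1#))))
      ≈ q ^ (binomials + (k + 1) C 2 + t * L) ⊛ fact ∣α∣ ⊛ fact (k + (x + y)) ⊛ 1#
    quinvSum-greater k x t y L≡ ∣α∣≡ = multiplyOut (binomials + k C 2) (k + t * (k + suc x)) k x y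
      (quinvSum≈wordSum k D?)
      (trans
        (trans
          (wordSum-cong D? O? (All.universal {P = U} (λ _ → tt) (n ∷ 1 ∷ middle)) N
            (λ w _ len → W>⇔ k x t L≡ (≡.subst (t ≤_) (≡.sym ∣α∣≡) (ℕₚ.m≤m+n t y)) w len))
          (reflexive (≡.cong (wordSum O? (n ∷ 1 ∷ middle)) (N≡ k (suc x) L≡))))
        (wordSum-greater α ([⋯⟩-sorted 2 n) 1<middle <n k x t y ∣α∣≡))
      exponent
      where
      D? : Decidable (λ w → W> k w × p₁ w ≡ suc t)
      D? w = W>? k w ×-dec (p₁ w ≟ suc t)

      O? : Decidable (Outer α n middle (λ b → suc t < firstTrue b) (λ b → firstTrue b ≡ suc t) k (suc x))
      O? = outer? α n middle (λ b → suc t <? firstTrue b) (λ b → firstTrue b ≟ suc t) k (suc x)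

      -- The k absorbed here comes from the i-th leading letter, beyond the i - 1 that give (i -
      -- 1)L.
      [k+1]C2 : (k + 1) C 2 ≡ k + k C 2
      [k+1]C2 = ≡.trans (≡.cong (_C 2) (ℕₚ.+-comm k 1))
        (≡.trans (≡.sym (nCk+nC[k+1]≡[n+1]C[k+1] k 1)) (≡.cong (_+ k C 2) (nC1≡n k)))

      shuffle : ∀ b c k s → b + c + (k + s) ≡ b + (k + c) + s
      shuffle = solve-∀

      exponent : binomials + k C 2 + (k + t * (k + suc x)) ≡ binomials + (k + 1) C 2 + t * L
      exponent = ≡.trans (shuffle binomials (k C 2) k (t * (k + suc x)))
        (≡.cong₂ (λ c l → binomials + c + t * l) (≡.sym [k+1]C2) (≡.sym L≡))

    quinvSum-atMost : ∀ k x t y → L ≡ suc k + x → ∣α∣ ≡ t + y →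
      quinvSum (suc k) (λ w → W≤? (suc k) w ×-dec (pₙ w ≟ suc t))
        ⊛ ((1# ⊛ ∏ (map (fact ∘ α) middle)) ⊛ (fact k ⊛ (fact y ⊛ (fact x ⊛ 1#))))
      ≈ q ^ (binomials + suc k C 2 + t * L) ⊛ fact ∣α∣ ⊛ fact (k + (x + y)) ⊛ 1#
    quinvSum-atMost k x t y L≡ ∣α∣≡ = multiplyOut (binomials + suc k C 2) (t * (suc k + x)) k x y
      (quinvSum≈wordSum (suc k) D?)
      (trans
        (trans
          (wordSum-cong D? O? (All.universal {P = U} (λ _ → tt) (n ∷ 1 ∷ middle)) N
            (λ w _ len → W≤⇔ k x t L≡ (≡.subst (t ≤_) (≡.sym ∣α∣≡) (ℕₚ.m≤m+n t y)) w len))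
          (reflexive (≡.cong (wordSum O? (n ∷ 1 ∷ middle)) (N≡ (suc k) x L≡))))
        (wordSum-atMost α ([⋯⟩-sorted 2 n) 1<middle <n k x t y ∣α∣≡))
      (≡.cong (λ l → binomials + suc k C 2 + t * l) (≡.sym L≡))
      where
      D? : Decidable (λ w → W≤ (suc k) w × pₙ w ≡ suc t)
      D? w = W≤? (suc k) w ×-dec (pₙ w ≟ suc t)

      O? : Decidable (Outer α n middle (λ b → firstTrue b ≡ suc t) (λ b → t < firstTrue b) (suc k) x)
      O? = outer? α n middle (λ b → firstTrue b ≟ suc t) (λ b → t <? firstTrue b) (suc k) x

-- Polynomials

open import Data.Integer using (+_)

-- _≈ₚ_ unfolds to a function type, from which Agda cannot infer the polynomials.
infix 4 _≋_
record _≋_ (p r : Poly) : Set where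
  constructor mk
  field coeffs : p ≈ₚ r

open _≋_

-- Coefficient lists as a commutative semiring

≋-refl : ∀ {p} → p ≋ p
≋-refl .coeffs d = ≡.refl

≋-sym : ∀ {p r} → p ≋ r → r ≋ p
≋-sym e .coeffs d = ≡.sym (coeffs e d)

≋-trans : ∀ {p r s} → p ≋ r → r ≋ s → p ≋ s
≋-trans e f .coeffs d = ≡.trans (coeffs e d) (coeffs f d)

∷-cong : ∀ {a b p r} → a ≡ b → p ≋ r → a ∷ p ≋ b ∷ r
∷-cong a≡b e .coeffs zero    = a≡b
∷-cong a≡b e .coeffs (suc d) = coeffs e d

0∷[] : 0ℤ ∷ [] ≋ []
0∷[] .coeffs zero    = ≡.refl
0∷[] .coeffs (suc d) = ≡.refl

+ₚ-cong : ∀ {p p′ r r′} → p ≋ p′ → r ≋ r′ → p +ₚ r ≋ p′ +ₚ r′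
+ₚ-cong {p} {p′} {r} {r′} e f .coeffs d = ≡.trans (coeff-+ p r d)
  (≡.trans (≡.cong₂ ℤ._+_ (coeffs e d) (coeffs f d)) (≡.sym (coeff-+ p′ r′ d)))

+ₚ-assoc : ∀ p r s → (p +ₚ r) +ₚ s ≋ p +ₚ (r +ₚ s)
+ₚ-assoc []      r       s       = ≋-refl
+ₚ-assoc (a ∷ p) []      s       = ≋-refl
+ₚ-assoc (a ∷ p) (b ∷ r) []      = ≋-refl
+ₚ-assoc (a ∷ p) (b ∷ r) (c ∷ s) = ∷-cong (ℤₚ.+-assoc a b c) (+ₚ-assoc p r s)

+ₚ-comm : ∀ p r → p +ₚ r ≋ r +ₚ p
+ₚ-comm []      []      = ≋-refl
+ₚ-comm []      (b ∷ r) = ≋-refl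
+ₚ-comm (a ∷ p) []      = ≋-refl
+ₚ-comm (a ∷ p) (b ∷ r) = ∷-cong (ℤₚ.+-comm a b) (+ₚ-comm p r)

+ₚ-swap : ∀ p r s → p +ₚ (r +ₚ s) ≋ r +ₚ (p +ₚ s)
+ₚ-swap p r s = ≋-trans (≋-sym (+ₚ-assoc p r s)) (≋-trans (+ₚ-cong (+ₚ-comm p r) ≋-refl) (+ₚ-assoc r p s))

+ₚ-interchange : ∀ p r s t → (p +ₚ r) +ₚ (s +ₚ t) ≋ (p +ₚ s) +ₚ (r +ₚ t)
+ₚ-interchange p r s t = ≋-trans (+ₚ-assoc p r (s +ₚ t))
  (≋-trans (+ₚ-cong (≋-refl {p}) (+ₚ-swap r s t)) (≋-sym (+ₚ-assoc p s (r +ₚ t))))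

scale : ℤ → Poly → Poly
scale a = map (a ℤ.*_)

scale-cong : ∀ a {p r} → p ≋ r → scale a p ≋ scale a r
scale-cong a {p} {r} e .coeffs d = ≡.trans (coeff-map a p d)
  (≡.trans (≡.cong (a ℤ.*_) (coeffs e d)) (≡.sym (coeff-map a r d)))

scale-+ₚ : ∀ a p r → scale a (p +ₚ r) ≋ scale a p +ₚ scale a r
scale-+ₚ a []      r       = ≋-refl
scale-+ₚ a (b ∷ p) []      = ≋-refl
scale-+ₚ a (b ∷ p) (c ∷ r) = ∷-cong (ℤₚ.*-distribˡ-+ a b c) (scale-+ₚ a p r)

scale-+ : ∀ a b p → scale (a ℤ.+ b) p ≋ scale a p +ₚ scale b p
scale-+ a b []      = ≋-refl
scale-+ a b (c ∷ p) = ∷-cong (ℤₚ.*-distribʳ-+ c a b) (scale-+ a b p)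

scale-* : ∀ a b p → scale (a ℤ.* b) p ≋ scale a (scale b p)
scale-* a b []      = ≋-refl
scale-* a b (c ∷ p) = ∷-cong (ℤₚ.*-assoc a b c) (scale-* a b p)

scale-0 : ∀ p → scale 0ℤ p ≋ []
scale-0 []      = ≋-refl
scale-0 (a ∷ p) = ≋-trans (∷-cong (ℤₚ.*-zeroˡ a) (scale-0 p)) 0∷[]

scale-1 : ∀ p → scale 1ℤ p ≋ p
scale-1 []      = ≋-refl
scale-1 (a ∷ p) = ∷-cong (ℤₚ.*-identityˡ a) (scale-1 p)

*ₚ-congˡ : ∀ p {r s} → r ≋ s → p *ₚ r ≋ p *ₚ s
*ₚ-congˡ []      e = ≋-refl
*ₚ-congˡ (a ∷ p) e = +ₚ-cong (scale-cong a e) (∷-cong ≡.refl (*ₚ-congˡ p e))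

*ₚ-zeroʳ : ∀ p → p *ₚ [] ≋ []
*ₚ-zeroʳ []      = ≋-refl
*ₚ-zeroʳ (a ∷ p) = ≋-trans (∷-cong ≡.refl (*ₚ-zeroʳ p)) 0∷[]

-- The mirror image of the defining recursion on the left factor; commutativity follows from it by
-- induction.
*ₚ-∷ : ∀ p b r → p *ₚ (b ∷ r) ≋ scale b p +ₚ (0ℤ ∷ p *ₚ r)
*ₚ-∷ []      b r = ≋-sym 0∷[]
*ₚ-∷ (a ∷ p) b r = ∷-cong (≡.cong (ℤ._+ 0ℤ) (ℤₚ.*-comm a b))
  (≋-trans (+ₚ-cong ≋-refl (*ₚ-∷ p b r)) (+ₚ-swap (scale a r) (scale b p) (0ℤ ∷ p *ₚ r)))

*ₚ-comm : ∀ p r → p *ₚ r ≋ r *ₚ p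
*ₚ-comm []      r = ≋-sym (*ₚ-zeroʳ r)
*ₚ-comm (a ∷ p) r = ≋-trans (+ₚ-cong ≋-refl (∷-cong ≡.refl (*ₚ-comm p r))) (≋-sym (*ₚ-∷ r a p))

*ₚ-cong : ∀ {p p′ r r′} → p ≋ p′ → r ≋ r′ → p *ₚ r ≋ p′ *ₚ r′
*ₚ-cong {p} {p′} {r} {r′} e f = ≋-trans (*ₚ-congˡ p f)
  (≋-trans (*ₚ-comm p r′) (≋-trans (*ₚ-congˡ r′ e) (*ₚ-comm r′ p′)))

*ₚ-distribʳ : ∀ s p r → (p +ₚ r) *ₚ s ≋ p *ₚ s +ₚ r *ₚ s
*ₚ-distribʳ s []      r       = ≋-refl
*ₚ-distribʳ s (a ∷ p) []      = +ₚ-comm [] ((a ∷ p) *ₚ s)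
*ₚ-distribʳ s (a ∷ p) (b ∷ r) = ≋-trans
  (+ₚ-cong (scale-+ a b s) (∷-cong ≡.refl (*ₚ-distribʳ s p r)))
  (+ₚ-interchange (scale a s) (scale b s) (0ℤ ∷ p *ₚ s) (0ℤ ∷ r *ₚ s))

scale-*ₚ : ∀ a p r → scale a p *ₚ r ≋ scale a (p *ₚ r)
scale-*ₚ a []      r = ≋-refl
scale-*ₚ a (b ∷ p) r = ≋-trans
  (+ₚ-cong (scale-* a b r) (∷-cong (≡.sym (ℤₚ.*-zeroʳ a)) (scale-*ₚ a p r)))
  (≋-sym (scale-+ₚ a (scale b r) (0ℤ ∷ p *ₚ r)))

0∷-*ₚ : ∀ p r → (0ℤ ∷ p) *ₚ r ≋ 0ℤ ∷ p *ₚ r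
0∷-*ₚ p r = +ₚ-cong (scale-0 r) ≋-refl

*ₚ-assoc : ∀ p r s → (p *ₚ r) *ₚ s ≋ p *ₚ (r *ₚ s)
*ₚ-assoc []      r s = ≋-refl
*ₚ-assoc (a ∷ p) r s = ≋-trans (*ₚ-distribʳ s (scale a r) (0ℤ ∷ p *ₚ r))
  (+ₚ-cong (scale-*ₚ a r s) (≋-trans (0∷-*ₚ (p *ₚ r) s) (∷-cong ≡.refl (*ₚ-assoc p r s))))

*ₚ-identityˡ : ∀ p → 1ₚ *ₚ p ≋ p
*ₚ-identityˡ p = ≋-trans (+ₚ-cong (scale-1 p) 0∷[]) (+ₚ-comm p [])

polySemiring : CommutativeSemiring 0ℓ 0ℓ
polySemiring = record
  { Carrier = Poly
  ; _≈_     = _≋_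
  ; _+_     = _+ₚ_
  ; _*_     = _*ₚ_
  ; 0#      = 0ₚ
  ; 1#      = 1ₚ
  ; isCommutativeSemiring = Biased.isCommutativeSemiringˡ record
    { +-isCommutativeMonoid = Biased.isCommutativeMonoidˡ record
      { isSemigroup = record
        { isMagma = record { isEquivalence = ≋-equivalence ; ∙-cong = +ₚ-cong }
        ; assoc   = +ₚ-assoc
        }
      ; identityˡ = λ _ → ≋-refl
      ; comm      = +ₚ-comm
      }
    ; *-isCommutativeMonoid = Biased.isCommutativeMonoidˡ record
      { isSemigroup = record
        { isMagma = record { isEquivalence = ≋-equivalence ; ∙-cong = *ₚ-cong }
        ; assoc   = *ₚ-assoc
        }
      ; identityˡ = *ₚ-identityˡ
      ; comm      = *ₚ-comm
      }
    ; distribʳ = *ₚ-distribʳ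
    ; zeroˡ    = λ _ → ≋-refl
    }
  }
  where
  ≋-equivalence : IsEquivalence _≋_
  ≋-equivalence = record { refl = ≋-refl ; sym = ≋-sym ; trans = ≋-trans }

-- Powers of q, q-factorials and q-multinomials as polynomials and fractions

qₚ : Poly
qₚ = 0ℤ ∷ 1ₚ

open Sums polySemiring qₚ using (fact; ∏) renaming ([_] to [_]ₚ)
open import Algebra.Properties.Semiring.Exp (CommutativeSemiring.semiring polySemiring) using (_^_)

qₚ-*ₚ : ∀ p → qₚ *ₚ p ≋ 0ℤ ∷ p
qₚ-*ₚ p = ≋-trans (0∷-*ₚ 1ₚ p) (∷-cong ≡.refl (*ₚ-identityˡ p))

q^≋ : ∀ e → q^ e ≋ qₚ ^ e
q^≋ zero    = ≋-refl
q^≋ (suc e) = ≋-trans (∷-cong ≡.refl (q^≋ e)) (≋-sym (qₚ-*ₚ (qₚ ^ e)))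

q-int≋ : ∀ s → q-int s ≋ [ s ]ₚ
q-int≋ zero    = ≋-refl
q-int≋ (suc s) = ≋-trans (∷-cong ≡.refl (q-int≋ s)) (+ₚ-cong (≋-refl {1ₚ}) (≋-sym (qₚ-*ₚ [ s ]ₚ)))

q-fact≋ : ∀ m → q-fact m ≋ fact m
q-fact≋ zero    = ≋-refl
q-fact≋ (suc m) = *ₚ-cong (q-fact≋ m) (q-int≋ (suc m))

q-facts≋ : ∀ (α : ℕ → ℕ) As → productₚ (map (λ b → q-fact ∣ b ∣) (map (λ i → + α i) As)) ≋ ∏ (map (fact ∘ α) As)
q-facts≋ α []       = ≋-refl
q-facts≋ α (a ∷ As) = *ₚ-cong (q-fact≋ (α a)) (q-facts≋ α As)

sumₚ-cong : ∀ {A : Set} {f g : A → Poly} → (∀ x → f x ≋ g x) → ∀ xs → sumₚ (map f xs) ≋ sumₚ (map g xs)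
sumₚ-cong e []       = ≋-refl
sumₚ-cong e (x ∷ xs) = +ₚ-cong (e x) (sumₚ-cong e xs)

q-multinomial-nonNegative : ∀ m β → All (0ℤ ℤ.≤_) β →
  q-multinomial m β ≡ frac (q-fact m) (productₚ (map (λ b → q-fact ∣ b ∣) β)) (q-facts-nonzero β)
q-multinomial-nonNegative m β β≥0 rewrite dec-true (all? (0ℤ ℤ.≤?_) β) β≥0 = ≡.refl

-- Once β is a list of three explicit nonnegative integers, the test in its multinomial computes;
-- for the list of α, of unknown length, the test is settled by the rewrite.
≃-multinomials : ∀ e k x y (α : ℕ → ℕ) As {S T m₀ m m₀′ m′ β} → S ≋ T → m₀ ≡ m → m₀′ ≡ m′ → β ≡ + k ∷ + y ∷ + x ∷ [] →
  T *ₚ ((1ₚ *ₚ ∏ (map (fact ∘ α) As)) *ₚ (fact k *ₚ (fact y *ₚ (fact x *ₚ 1ₚ))))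
    ≋ qₚ ^ e *ₚ fact m *ₚ fact m′ *ₚ 1ₚ →
  ⟦ S ⟧ ≃ ⟦ q^ e ⟧ · q-multinomial m₀ (map (λ i → + α i) As) · q-multinomial m₀′ β
≃-multinomials e k x y α As {m₀ = m} {m₀′ = m′} S≋T ≡.refl ≡.refl ≡.refl eq
  rewrite q-multinomial-nonNegative m (map (λ i → + α i) As) (All.map⁺ (All.universal (λ _ → ℤ.+≤+ z≤n) As))
  = coeffs (≋-trans
      (*ₚ-cong S≋T (*ₚ-cong (*ₚ-cong (≋-refl {1ₚ}) (q-facts≋ α As))
        (*ₚ-cong (q-fact≋ k) (*ₚ-cong (q-fact≋ y) (*ₚ-cong (q-fact≋ x) (≋-refl {1ₚ}))))))
      (≋-trans eq
        (≋-sym (*ₚ-cong (*ₚ-cong (*ₚ-cong (q^≋ e) (q-fact≋ m)) (q-fact≋ m′)) (≋-refl {1ₚ})))))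

mainTheorem18 : (n : ℕ) (α : ℕ → ℕ) (N ℓ : ℕ) →
    let open Setup n α N ℓ in
    3 ≤ n →
    (∀ i → 2 ≤ i → i < n → 1 ≤ α i) →
    ∣α∣ < N →
    2 ≤ ℓ → ℓ ≤ n →
    (∀ k i → 0 ≤ k → k ≤ L ∸ 1 → 1 ≤ i → i ≤ N ∸ L + 1 →
    ⟦ Σq^quinv′ k (λ w → W>? k w ×-dec (p₁ w ≟ i)) ⟧
    ≃ ⟦ q^ (binomials + (k + 1) C 2 + (i ∸ 1) * L) ⟧
    · q-multinomial (N ∸ L) αs
    · q-multinomial (N ∸ i) (+ k ∷ + N ℤ.- + L ℤ.- + i ℤ.+ 1ℤ ∷ + L ℤ.- + k ℤ.- 1ℤ ∷ []))
    ×
    (∀ k j → 1 ≤ k → k ≤ L → 1 ≤ j → j ≤ N ∸ L + 1 →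
    ⟦ Σq^quinv′ k (λ w → W≤? k w ×-dec (pₙ w ≟ j)) ⟧
    ≃ ⟦ q^ (binomials + k C 2 + (j ∸ 1) * L) ⟧
    · q-multinomial (N ∸ L) αs
    · q-multinomial (N ∸ j) (+ k ℤ.- 1ℤ ∷ + N ℤ.- + L ℤ.- + j ℤ.+ 1ℤ ∷ + L ℤ.- + k ∷ []))
mainTheorem18 n α N ℓ 2<n _ ∣α∣<N _ _ = part₁ , part₂
  where
  open Setup n α N ℓ
  open Reduction n α N ℓ 2<n ∣α∣<N

  N∸L≡∣α∣ : N ∸ L ≡ ∣α∣
  N∸L≡∣α∣ = ℕₚ.m∸[m∸n]≡n (ℕₚ.<⇒≤ ∣α∣<N)

  N≡L+∣α∣ : N ≡ L + ∣α∣
  N≡L+∣α∣ = ≡.trans (≡.sym ∣α∣+L≡N) (ℕₚ.+-comm ∣α∣ L)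

  -- The range of i and j says t ≤ |α|, so the number y = |α| - t of free middle letters is an
  -- honest difference.
  ∣α∣≡ : ∀ {t} → suc t ≤ N ∸ L + 1 → ∣α∣ ≡ t + (∣α∣ ∸ t)
  ∣α∣≡ {t} t<N∸L+1 = ≡.sym (ℕₚ.m+[n∸m]≡n (ℕ.s≤s⁻¹
    (≡.subst (suc t ≤_) (≡.trans (≡.cong (_+ 1) N∸L≡∣α∣) (ℕₚ.+-comm ∣α∣ 1)) t<N∸L+1)))

  middle-entry : ∀ t y → ∣α∣ ≡ t + y → + N ℤ.- + L ℤ.- + suc t ℤ.+ 1ℤ ≡ + y
  middle-entry t y ∣α∣≡t+y = ≡.trans
    (≡.cong (λ m → + m ℤ.- + L ℤ.- + suc t ℤ.+ 1ℤ) (≡.trans N≡L+∣α∣ (≡.cong (λ m → L + m) ∣α∣≡t+y)))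
    (cancel (+ L) (+ t) (+ y))
    where
    cancel : ∀ l t y → (l ℤ.+ (t ℤ.+ y)) ℤ.- l ℤ.- (1ℤ ℤ.+ t) ℤ.+ 1ℤ ≡ y
    cancel = ℤ-Solver.solve-∀

  N∸[1+t]≡ : ∀ k x t y → L ≡ suc k + x → ∣α∣ ≡ t + y → N ∸ suc t ≡ k + (x + y)
  N∸[1+t]≡ k x t y L≡ ∣α∣≡t+y = ≡.trans
    (≡.cong (_∸ suc t) (≡.trans N≡L+∣α∣ (≡.trans (≡.cong₂ _+_ L≡ ∣α∣≡t+y) (shuffle k x t y))))
    (ℕₚ.m+n∸m≡n (suc t) (k + (x + y)))
    where
    shuffle : ∀ k x t y → suc k + x + (t + y) ≡ suc t + (k + (x + y))
    shuffle = solve-∀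

  Σq^quinv′≋ : ∀ k {P : Pred Word 0ℓ} (P? : Decidable P) → Σq^quinv′ k P? ≋ quinvSum polySemiring qₚ k P?
  Σq^quinv′≋ k P? = sumₚ-cong (λ w → q^≋ (quinv′ k w)) (filter P? (words n N))

  part₁ : ∀ k i → 0 ≤ k → k ≤ L ∸ 1 → 1 ≤ i → i ≤ N ∸ L + 1 →
    ⟦ Σq^quinv′ k (λ w → W>? k w ×-dec (p₁ w ≟ i)) ⟧
    ≃ ⟦ q^ (binomials + (k + 1) C 2 + (i ∸ 1) * L) ⟧
    · q-multinomial (N ∸ L) αs
    · q-multinomial (N ∸ i) (+ k ∷ + N ℤ.- + L ℤ.- + i ℤ.+ 1ℤ ∷ + L ℤ.- + k ℤ.- 1ℤ ∷ [])
  part₁ k (suc t) _ k≤L∸1 _ i≤ =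
    ≃-multinomials (binomials + (k + 1) C 2 + t * L) k x y α middle (Σq^quinv′≋ k (λ w → W>? k w ×-dec (p₁ w ≟ suc t)))
      N∸L≡∣α∣ (N∸[1+t]≡ k x t y L≡ (∣α∣≡ i≤))
      (≡.cong₂ (λ a b → + k ∷ a ∷ b ∷ []) (middle-entry t y (∣α∣≡ i≤)) last-entry)
      (quinvSum-greater polySemiring qₚ k x t y (≡.trans L≡ (≡.sym (ℕₚ.+-suc k x))) (∣α∣≡ i≤))
    where
    x y : ℕ
    x = L ∸ 1 ∸ k
    y = ∣α∣ ∸ t

    L≡ : L ≡ suc k + x
    -- From |α| < N follows L ≥ 1, so the truncated `L ∸ 1` is a true predecessor and at least one
    -- letter 1 is present.
    L≡ = ≡.trans (≡.sym (ℕₚ.m+[n∸m]≡n (ℕₚ.m<n⇒0<n∸m ∣α∣<N))) (≡.cong suc (≡.sym (ℕₚ.m+[n∸m]≡n k≤L∸1)))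

    last-entry : + L ℤ.- + k ℤ.- 1ℤ ≡ + x
    last-entry = ≡.trans (≡.cong (λ l → + l ℤ.- + k ℤ.- 1ℤ) L≡) (cancel (+ k) (+ x))
      where
      cancel : ∀ k x → (1ℤ ℤ.+ k ℤ.+ x) ℤ.- k ℤ.- 1ℤ ≡ x
      cancel = ℤ-Solver.solve-∀

  part₂ : ∀ k j → 1 ≤ k → k ≤ L → 1 ≤ j → j ≤ N ∸ L + 1 →
    ⟦ Σq^quinv′ k (λ w → W≤? k w ×-dec (pₙ w ≟ j)) ⟧
    ≃ ⟦ q^ (binomials + k C 2 + (j ∸ 1) * L) ⟧
    · q-multinomial (N ∸ L) αs
    · q-multinomial (N ∸ j) (+ k ℤ.- 1ℤ ∷ + N ℤ.- + L ℤ.- + j ℤ.+ 1ℤ ∷ + L ℤ.- + k ∷ [])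
  part₂ (suc k) (suc t) _ k≤L _ j≤ =
    ≃-multinomials (binomials + suc k C 2 + t * L) k x y α middle (Σq^quinv′≋ (suc k) (λ w → W≤? (suc k) w ×-dec (pₙ w ≟ suc t)))
      N∸L≡∣α∣ (N∸[1+t]≡ k x t y L≡ (∣α∣≡ j≤))
      -- The first entry `+ suc k ℤ.- 1ℤ` computes to `+ k`: the first n has a prescribed place, and
      -- k others are free.
      (≡.cong₂ (λ a b → + k ∷ a ∷ b ∷ []) (middle-entry t y (∣α∣≡ j≤)) last-entry)
      (quinvSum-atMost polySemiring qₚ k x t y L≡ (∣α∣≡ j≤))
    where
    x y : ℕ
    x = L ∸ suc k
    y = ∣α∣ ∸ t

    L≡ : L ≡ suc k + x
    L≡ = ≡.sym (ℕₚ.m+[n∸m]≡n k≤L)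

    last-entry : + L ℤ.- + suc k ≡ + x
    last-entry = ≡.trans (≡.cong (λ l → + l ℤ.- + suc k) L≡) (cancel (1ℤ ℤ.+ + k) (+ x))
      where
      cancel : ∀ k x → (k ℤ.+ x) ℤ.- k ≡ x
      cancel = ℤ-Solver.solve-∀
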